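{- Let $G$ be a finite connected non-bipartite undirected graph. Then $G$ admits a 2-edge-colouring $c:E(G)\to\{1,2\}$ under which it is properly connected if and only if there exists an $\mathscr S$-free component $\mathcal K$ of $G$ such that $G\setminus\mathcal K$ is empty or can be made 2-edge-connected by adding at most one edge.
   Context: A walk is a sequence of vertices $v_0,\dots,v_l$ with consecutive vertices adjacent (vertices and edges may repeat); its length is $l$; it is closed if $v_0=v_l$. A walk in an edge-coloured graph is properly coloured if no two consecutive edges of it have the same colour. The coloured graph is properly connected if every two vertices are joined by a properly coloured walk. An edge is stubborn if it belongs to every closed walk of odd length in $G$; $\mathscr S$ is the set of stubborn edges. An $\mathscr S$-free component is (the vertex set of) a connected component of $G\setminus\mathscr S$ (the graph with all stubborn edges deleted). $G\setminus\mathcal K$ denotes the subgraph induced on $V(G)\setminus\mathcal K$. A graph is 2-edge-connected if it is connected and bridgeless (a single vertex counts); a graph "can be made 2-edge-connected by adding at most one edge" if it is 2-edge-connected or there is an edge $e$ (possibly parallel to an existing edge) whose addition makes it 2-edge-connected. -}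

module Defs where

open import Data.Nat using (ℕ; zero; suc; _*_)
open import Data.Fin using (Fin)
open import Data.Bool using (Bool; true; false)
open import Data.List using (List; []; _∷_; length)
open import Data.List.Relation.Unary.All using (All)
open import Data.List.Relation.Unary.Any using (Any)
open import Data.Product using (_×_; _,_; ∃-syntax; Σ)
open import Data.Sum using (_⊎_)
open import Relation.Binary.PropositionalEquality using (_≡_; _≢_)
open import Relation.Nullary using (¬_)

record Graph (n : ℕ) : Set where
  field
    adj   : Fin n → Fin n → Bool
    sym   : ∀ u v → adj u v ≡ adj v u
    irrefl : ∀ v → adj v v ≡ false

module _ {n : ℕ} where

  Rel : Set₁
  Rel = Fin n → Fin n → Set

  Adj : Graph n → Rel
  Adj G u v = Graph.adj G u v ≡ true

  -- WalkFrom R u vs v : the vertex sequence u ∷ vs is a walk in R from u to v.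
  -- Its length is  length vs.
  data WalkFrom (R : Rel) : Fin n → List (Fin n) → Fin n → Set where
    stop : ∀ v → WalkFrom R v [] v
    step : ∀ {u w vs v} → R u w → WalkFrom R w vs v → WalkFrom R u (w ∷ vs) v

  consec : List (Fin n) → List (Fin n × Fin n)
  consec (x ∷ y ∷ r) = (x , y) ∷ consec (y ∷ r)
  consec _ = []

  UsesEdge : Fin n → Fin n → List (Fin n) → Set
  UsesEdge a b vs = Any (λ p → p ≡ (a , b) ⊎ p ≡ (b , a)) (consec vs)

  Odd : ℕ → Set
  Odd m = ∃[ k ] m ≡ suc (2 * k)

  Stubborn : Graph n → Fin n → Fin n → Set
  Stubborn G a b = Adj G a b ×
    (∀ u vs → WalkFrom (Adj G) u vs u → Odd (length vs) → UsesEdge a b (u ∷ vs))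

  AdjNoStubborn : Graph n → Rel
  AdjNoStubborn G u v = Adj G u v × ¬ Stubborn G u v

  VSet : Set
  VSet = Fin n → Bool

  _∈ₛ_ : Fin n → VSet → Set
  v ∈ₛ K = K v ≡ true

  JoinedIn : (Fin n → Set) → Rel → Fin n → Fin n → Set
  JoinedIn P R u v = ∃[ vs ] (WalkFrom R u vs v × All P (u ∷ vs))

  -- the graph (P, R) is connected (empty vertex set allowed)
  ConnectedOn : (Fin n → Set) → Rel → Set
  ConnectedOn P R = ∀ u v → P u → P v → JoinedIn P R u v

  Connected : Graph n → Set
  Connected G = ConnectedOn (λ _ → Fin n) (Adj G)

  Bipartite : Graph n → Set
  Bipartite G = Σ (Fin n → Bool) λ f → ∀ u v → Adj G u v → f u ≢ f v

  SFreeComponent : Graph n → VSet → Set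
  SFreeComponent G K =
    (∃[ v ] v ∈ₛ K) ×
    (∀ u v → u ∈ₛ K → v ∈ₛ K → JoinedIn (λ _ → Fin n) (AdjNoStubborn G) u v) ×
    (∀ u v → u ∈ₛ K → JoinedIn (λ _ → Fin n) (AdjNoStubborn G) u v → v ∈ₛ K)

  OutK : VSet → Fin n → Set
  OutK K v = K v ≡ false

  EmptyOutside : VSet → Set
  EmptyOutside K = ∀ v → v ∈ₛ K

  SameEdge : Fin n → Fin n → Fin n → Fin n → Set
  SameEdge x y a b = (x ≡ a × y ≡ b) ⊎ (x ≡ b × y ≡ a)

  TwoEdgeConnected : Graph n → VSet → Set
  TwoEdgeConnected G K =
    ConnectedOn (OutK K) (Adj G) ×
    (∀ a b → OutK K a → OutK K b → Adj G a b →
      ConnectedOn (OutK K) (λ x y → Adj G x y × ¬ SameEdge x y a b))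

  -- G ∖ K plus one new edge {p,q} (a multigraph: the new edge may be parallel
  -- to an existing one) is 2-edge-connected: connected, removing the new edge
  -- keeps it connected, and removing any old edge keeps it connected.
  TwoEdgeConnectedPlus : Graph n → VSet → Fin n → Fin n → Set
  TwoEdgeConnectedPlus G K p q =
    ConnectedOn (OutK K) (λ x y → Adj G x y ⊎ SameEdge x y p q) ×
    ConnectedOn (OutK K) (Adj G) ×
    (∀ a b → OutK K a → OutK K b → Adj G a b →
      ConnectedOn (OutK K) (λ x y → (Adj G x y × ¬ SameEdge x y a b) ⊎ SameEdge x y p q))

  AlmostTwoEdgeConnected : Graph n → VSet → Set
  AlmostTwoEdgeConnected G K =
    TwoEdgeConnected G K ⊎
    (∃[ p ] ∃[ q ] (OutK K p × OutK K q × TwoEdgeConnectedPlus G K p q))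

  Colouring : Set
  Colouring = Fin n → Fin n → Fin 2

  IsColouring : Colouring → Set
  IsColouring c = ∀ u v → c u v ≡ c v u

  data ProperlyColoured (c : Colouring) : List (Fin n) → Set where
    pc0 : ProperlyColoured c []
    pc1 : ∀ x → ProperlyColoured c (x ∷ [])
    pc2 : ∀ x y → ProperlyColoured c (x ∷ y ∷ [])
    pc3 : ∀ {x y z r} → c x y ≢ c y z → ProperlyColoured c (y ∷ z ∷ r) →
          ProperlyColoured c (x ∷ y ∷ z ∷ r)

  ProperlyConnected : Graph n → Colouring → Set
  ProperlyConnected G c = ∀ u v →
    ∃[ vs ] (WalkFrom (Adj G) u vs v × ProperlyColoured c (u ∷ vs))

{-# OPTIONS --safe #-}
module Submission where

-- A properly coloured walk is a directed walk in the double cover Fin n × Bool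
-- of G: from (u , a) one may go to (v , not a) along an edge uv of colour a, and
-- (v , a) ↦ (v , not a) reverses all arcs.  A colouring thus orients both lifts
-- of every edge at once.
--
-- Sufficiency.  Colour the edges one at a time, keeping the double cover (in which
-- uncoloured edges may be used both ways) strongly connected.  This fails only at
-- stubborn edges and at bridges with a bipartite side.  If there are no stubborn
-- edges, direct one copy of each such side towards the rest, coherently for nested
-- sides by means of the parity of the distance to a fixed vertex.  If xy is
-- stubborn, G ∖ xy is bipartite, its double cover consists of two copies with
-- opposite orientations, and all remaining edges are bridges of G ∖ xy.  Taking
-- x ∈ K and y ∉ K, direct those inside K towards x, the one leaving K outwards,
-- and those of G ∖ K along the path that carries all of them.
--
-- Necessity.  The stubborn edges are bridges of G ∖ xy, so some 𝒮-free component
-- K has a copy in the double cover which all stubborn edges leave.  Walks between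
-- vertices outside K then never meet K, hence G ∖ K is bipartite with a
-- semiconnected orientation; joining a vertex reached by all others to one
-- reaching all others makes it 2-edge-connected.

open import Defs
open import Data.Bool using (Bool; true; false; not; _xor_; _∧_; _∨_; if_then_else_)
open import Data.Bool.Properties using (not-involutive; not-¬; ¬-not; not-injective; xor-same; not-distribˡ-xor; ∨-comm) renaming (_≟_ to _≟ᵇ_)
open import Data.Empty using (⊥; ⊥-elim)
open import Data.Fin using (Fin; zero; suc)
open import Data.Fin.Properties using (any?; all?; <-cmp) renaming (_≟_ to _≟ᶠ_)
open import Data.List using (List; []; _∷_; length; allFin; cartesianProduct)
open import Data.List.Membership.Propositional using (_∈_)
open import Data.List.Membership.Propositional.Properties using (∈-allFin; ∈-cartesianProduct⁺)
open import Data.List.Relation.Unary.All as All using (All; []; _∷_)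
open import Data.List.Relation.Unary.Any using (here; there)
open import Data.Maybe using (Maybe; just; nothing)
open import Data.Nat using (ℕ; zero; suc; _*_; _+_; _<_; _≤_; z≤n; s≤s)
open import Data.Nat.Properties using (+-suc; <-irrefl; <-trans; <-asym; ≤-antisym; n<1+n; suc-injective)
open import Data.Product using (_×_; _,_; proj₁; proj₂; Σ; ∃; ∃-syntax)
open import Data.Product.Properties using (≡-dec)
open import Data.Sum as Sum using (_⊎_; inj₁; inj₂; swap; [_,_]; [_,_]′)
open import Data.Unit using (⊤; tt)
open import Function using (_∘_; id; case_of_)
open import Relation.Binary.Construct.Closure.ReflexiveTransitive using (Star; ε; _◅_; _◅◅_; return; gmap; reverse; _⋆)
open import Relation.Binary.Definitions using (DecidableEquality; Decidable; tri<; tri≈; tri>)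
open import Relation.Binary.PropositionalEquality using (_≡_; _≢_; refl; sym; trans; cong; cong₂; subst)
open import Relation.Nullary using (¬_; Dec; yes; no; does; contradiction)
open import Relation.Nullary.Decidable using (map′; _×-dec_; _⊎-dec_; ¬?; dec-true; dec-false)

-- Reachability

preserve : {V : Set} {R : V → V → Set} (Z : V → Set) →
  (∀ {s t} → R s t → Z s → Z t) → ∀ {s t} → Star R s t → Z s → Z t
preserve Z closed ε z = z
preserve Z closed (r ◅ p) z = preserve Z closed p (closed r z)

constant : {V A : Set} {R : V → V → Set} (h : V → A) →
  (∀ {s t} → R s t → h s ≡ h t) → ∀ {s t} → Star R s t → h s ≡ h t
constant h eq ε = refl
constant h eq (r ◅ p) = trans (eq r) (constant h eq p)

module Warshall {V : Set} (_≟_ : DecidableEquality V)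
  {R : V → V → Set} (R? : Decidable R) where

  Via : List V → V → V → Set
  Via []      u v = u ≡ v ⊎ R u v
  Via (z ∷ L) u v = Via L u v ⊎ (Via L u z × Via L z v)

  via? : ∀ L → Decidable (Via L)
  via? []      u v = (u ≟ v) ⊎-dec R? u v
  via? (z ∷ L) u v = via? L u v ⊎-dec (via? L u z ×-dec via? L z v)

  via⇒star : ∀ L {u v} → Via L u v → Star R u v
  via⇒star []      (inj₁ refl)    = ε
  via⇒star []      (inj₂ r)       = return r
  via⇒star (z ∷ L) (inj₁ p)       = via⇒star L p
  via⇒star (z ∷ L) (inj₂ (p , q)) = via⇒star L p ◅◅ via⇒star L q

  direct : ∀ L {u v} → u ≡ v ⊎ R u v → Via L u v
  direct []      p = p
  direct (z ∷ L) p = inj₁ (direct L p)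

  -- If the meeting vertex heads the list, its loops are dropped; if both walks pass through another
  -- head, the part between the two passages is dropped.
  via-trans : ∀ {L z u v} → z ∈ L → Via L u z → Via L z v → Via L u v
  via-trans {z ∷ L} (here refl) p q =
    inj₂ ([ id , proj₁ ] p , [ id , proj₂ ] q)
  via-trans {_ ∷ L} (there m) (inj₁ p)         (inj₁ q)         = inj₁ (via-trans m p q)
  via-trans {_ ∷ L} (there m) (inj₁ p)         (inj₂ (q₁ , q₂)) = inj₂ (via-trans m p q₁ , q₂)
  via-trans {_ ∷ L} (there m) (inj₂ (p₁ , p₂)) (inj₁ q)         = inj₂ (p₁ , via-trans m p₂ q)
  via-trans {_ ∷ L} (there m) (inj₂ (p₁ , _))  (inj₂ (_ , q₂))  = inj₂ (p₁ , q₂)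

  module _ (vs : List V) (complete : ∀ v → v ∈ vs) where

    star⇒via : ∀ {u v} → Star R u v → Via vs u v
    star⇒via ε       = direct vs (inj₁ refl)
    star⇒via (r ◅ p) = via-trans (complete _) (direct vs (inj₂ r)) (star⇒via p)

    abstract
      star? : Decidable (Star R)
      star? u v = map′ (via⇒star vs) star⇒via (via? vs u v)

module _ {n : ℕ} {R : Fin n → Fin n → Set} where

  reachable? : Decidable R → Decidable (Star R)
  reachable? R? = Warshall.star? _≟ᶠ_ R? (allFin n) ∈-allFin

  walk⇒star : ∀ {u vs v} → WalkFrom R u vs v → Star R u v
  walk⇒star (stop v)   = ε
  walk⇒star (step r w) = r ◅ walk⇒star w

  star⇒joined : ∀ {P : Fin n → Set} {u v} → P u → Star (λ a b → R a b × P b) u v → JoinedIn P R u v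
  star⇒joined pu ε = [] , stop _ , pu ∷ []
  star⇒joined pu ((r , pw) ◅ p) with star⇒joined pw p
  ... | vs , w , ps = _ ∷ vs , step r w , pu ∷ ps

joined⇒star : ∀ {n} {P : Fin n → Set} {R : Fin n → Fin n → Set} {u v} → JoinedIn P R u v →
  Star (λ x y → R x y × P x × P y) u v
joined⇒star (_ , stop _ , _) = ε
joined⇒star (_ , step r w , pu ∷ pw ∷ ps) = (r , pu , pw) ◅ joined⇒star (_ , w , pw ∷ ps)

sameEdge? : ∀ {n} (u v a b : Fin n) → Dec (SameEdge u v a b)
sameEdge? u v a b = ((u ≟ᶠ a) ×-dec (v ≟ᶠ b)) ⊎-dec ((u ≟ᶠ b) ×-dec (v ≟ᶠ a))

module _ {n : ℕ} {a b : Fin n} where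

  same-flipˡ : ∀ {u v} → SameEdge u v a b → SameEdge v u a b
  same-flipˡ (inj₁ (p , q)) = inj₂ (q , p)
  same-flipˡ (inj₂ (p , q)) = inj₁ (q , p)

  same-flipʳ : ∀ {u v} → SameEdge u v a b → SameEdge u v b a
  same-flipʳ = swap

  same-sym : ∀ {u v} → SameEdge u v a b → SameEdge a b u v
  same-sym (inj₁ (p , q)) = inj₁ (sym p , sym q)
  same-sym (inj₂ (p , q)) = inj₂ (sym q , sym p)

-- The double cover

State : ℕ → Set
State n = Fin n × Bool

σ : ∀ {n} → State n → State n
σ (v , a) = v , not a

-- E u v a : the edge uv may be traversed while having colour a.
Lift : ∀ {n} → (Fin n → Fin n → Bool → Set) → State n → State n → Set
Lift E (u , a) (v , b) = E u v a × b ≡ not a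

module _ {n : ℕ} {E : Fin n → Fin n → Bool → Set} where

  lift-reachable? : (∀ u v a → Dec (E u v a)) → Decidable (Star (Lift E))
  lift-reachable? E? = Warshall.star? (≡-dec _≟ᶠ_ _≟ᵇ_)
    (λ (u , a) (v , b) → E? u v a ×-dec (b ≟ᵇ not a))
    (cartesianProduct (allFin n) (false ∷ true ∷ []))
    (λ (v , a) → ∈-cartesianProduct⁺ (∈-allFin v) (colour a))
    where
    colour : ∀ a → a ∈ false ∷ true ∷ []
    colour false = here refl
    colour true  = there (here refl)

  module _ (E-sym : ∀ {u v a} → E u v a → E v u a) where

    σ-reverse : ∀ {s t} → Lift E s t → Lift E (σ t) (σ s)
    σ-reverse {u , a} {v , _} (e , refl) =
      subst (E v u) (sym (not-involutive a)) (E-sym e) , sym (not-involutive (not a))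

    σ-reverse⋆ : ∀ {s t} → Star (Lift E) s t → Star (Lift E) (σ t) (σ s)
    σ-reverse⋆ ε       = ε
    σ-reverse⋆ (r ◅ p) = σ-reverse⋆ p ◅◅ return (σ-reverse r)

parity : ℕ → Bool
parity zero    = false
parity (suc m) = not (parity m)

even-or-odd : ∀ m → (parity m ≡ false × ∃[ k ] m ≡ 2 * k) ⊎ (parity m ≡ true × ∃[ k ] m ≡ suc (2 * k))
even-or-odd zero = inj₁ (refl , 0 , refl)
even-or-odd (suc m) with even-or-odd m
... | inj₁ (p , k , refl) = inj₂ (cong not p , k , refl)
... | inj₂ (p , k , refl) = inj₁ (cong not p , suc k , cong suc (sym (+-suc k (k + 0))))

parity⇒odd : ∀ m → parity m ≡ true → ∃[ k ] m ≡ suc (2 * k)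
parity⇒odd m p with even-or-odd m
... | inj₁ (q , _) = contradiction (trans (sym q) p) λ ()
... | inj₂ (_ , o) = o

odd⇒parity : ∀ m → ∃[ k ] m ≡ suc (2 * k) → parity m ≡ true
odd⇒parity _ (k , refl) = cong not (double k)
  where
  double : ∀ k → parity (2 * k) ≡ false
  double zero = refl
  double (suc k) rewrite +-suc k (k + 0) = trans (not-involutive _) (double k)

-- Stubborn edges

xor-not : ∀ a b → a xor not b ≡ not a xor b
xor-not false b = refl
xor-not true  b = not-involutive b

flip-both : ∀ {p q p′ q′} → p′ ≡ not p → q′ ≡ not q → p xor q ≡ p′ xor q′
flip-both {true}      refl refl = refl
flip-both {false} {q} refl refl = sym (not-involutive q)

flip-one : ∀ {p q p′ q′} → p′ ≡ not p → q ≡ q′ → p xor q ≢ p′ xor q′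
flip-one {true}  {true}  refl refl ()
flip-one {true}  {false} refl refl ()
flip-one {false} {true}  refl refl ()
flip-one {false} {false} refl refl ()

module _ {n : ℕ} (G : Graph n) where

  adj-sym : ∀ {u v} → Adj G u v → Adj G v u
  adj-sym {u} {v} = trans (Graph.sym G v u)

  adj? : Decidable (Adj G)
  adj? u v = Graph.adj G u v ≟ᵇ true

  BipartiteWithout : Fin n → Fin n → (Fin n → Bool) → Set
  BipartiteWithout x y f = ∀ {u v} → Adj G u v → ¬ SameEdge u v x y → f v ≡ not (f u)

  bipartite⇒uses : ∀ {x y f} → BipartiteWithout x y f → ∀ {u vs v} → WalkFrom (Adj G) u vs v →
    UsesEdge x y (u ∷ vs) ⊎ f v ≡ parity (length vs) xor f u
  bipartite⇒uses bip (stop v) = inj₂ refl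
  bipartite⇒uses {x} {y} {f} bip {u} (step {w = w} {vs} uw walk) with sameEdge? u w x y
  ... | yes (inj₁ (refl , refl)) = inj₁ (here (inj₁ refl))
  ... | yes (inj₂ (refl , refl)) = inj₁ (here (inj₂ refl))
  ... | no ≠ with bipartite⇒uses {f = f} bip walk
  ...   | inj₁ used = inj₁ (there used)
  ...   | inj₂ eq = inj₂ (trans eq (trans (cong (parity (length vs) xor_) (bip uw ≠)) (xor-not (parity (length vs)) (f u))))

  -- A closed walk avoiding `xy` returns to the same value of `f`, so its length is even.
  bipartite⇒stubborn : ∀ {x y f} → Adj G x y → BipartiteWithout x y f → Stubborn G x y
  bipartite⇒stubborn {f = f} xy bip = xy , λ u vs walk odd →
    [ id , (λ eq → contradiction (trans eq (cong (_xor f u) (odd⇒parity _ odd))) (not-¬ refl)) ]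
      (bipartite⇒uses {f = f} bip walk)

  Without : Fin n → Fin n → Fin n → Fin n → Bool → Set
  Without x y u v _ = Adj G u v × ¬ SameEdge u v x y

  module _ {x y : Fin n} where

    without-sym : ∀ {u v a} → Without x y u v a → Without x y v u a
    without-sym (uv , ≠) = adj-sym uv , ≠ ∘ same-flipˡ

    without-reverse : ∀ {s t} → Star (Lift (Without x y)) s t → Star (Lift (Without x y)) t s
    without-reverse = reverse λ { {u , a} {v , b} (e , eq) →
      without-sym {a = a} e , trans (sym (not-involutive a)) (cong not (sym eq)) }

    without⇒walk : ∀ {u a v b} → Star (Lift (Without x y)) (u , a) (v , b) →
      ∃[ vs ] (WalkFrom (Adj G) u vs v × ¬ UsesEdge x y (u ∷ vs) × b ≡ parity (length vs) xor a)
    without⇒walk ε = [] , stop _ , (λ ()) , refl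
    without⇒walk {a = a} (((uw , ≠) , refl) ◅ p) with without⇒walk p
    ... | vs , walk , unused , eq =
      _ ∷ vs , step uw walk , fresh , trans eq (xor-not (parity (length vs)) a)
      where
      fresh : ¬ UsesEdge x y (_ ∷ _ ∷ vs)
      fresh (here (inj₁ refl)) = ≠ (inj₁ (refl , refl))
      fresh (here (inj₂ refl)) = ≠ (inj₂ (refl , refl))
      fresh (there used)       = unused used

    stubborn⇒no-odd : Stubborn G x y → ∀ z a → ¬ Star (Lift (Without x y)) (z , a) (z , not a)
    stubborn⇒no-odd (_ , uses) z a p with without⇒walk p
    ... | vs , walk , unused , eq = unused (uses z vs walk (parity⇒odd (length vs) (solve (parity (length vs)) a eq)))
      where
      solve : ∀ p a → not a ≡ p xor a → p ≡ true
      solve true  a     _ = refl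
      solve false true  ()
      solve false false ()

  module _ (connected : Connected G) where

    star-adj : ∀ u v → Star (Adj G) u v
    star-adj u v with connected u v u v
    ... | _ , walk , _ = walk⇒star walk

    module _ (x y : Fin n) where

      private
        _⇝_ = Star (Lift (Without x y))
        ⇝? = lift-reachable? {E = Without x y} λ u v _ → adj? u v ×-dec ¬? (sameEdge? u v x y)

        -- Without `xy` every vertex is still joined to `x` or to `y`. The label is the parity of a
        -- walk from `x`, or of a walk from `y` where `x` is out of reach.
        Label : Fin n → Bool → Set
        Label v a = ((x , false) ⇝ (v , a)) ⊎ ((∀ b → ¬ (x , false) ⇝ (v , b)) × (y , false) ⇝ (v , a))

        Covered : Fin n → Set
        Covered v = (∃[ a ] (x , false) ⇝ (v , a)) ⊎ (∃[ a ] (y , false) ⇝ (v , a))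

        covered : ∀ v → Covered v
        covered v = preserve Covered go (star-adj x v) (inj₁ (_ , ε))
          where
          go : ∀ {u v} → Adj G u v → Covered u → Covered v
          go {u} {v} uv cov with sameEdge? u v x y
          ... | yes (inj₁ (_ , refl)) = inj₂ (_ , ε)
          ... | yes (inj₂ (_ , refl)) = inj₁ (_ , ε)
          ... | no ≠ with cov
          ...   | inj₁ (a , p) = inj₁ (_ , p ◅◅ return ((uv , ≠) , refl))
          ...   | inj₂ (a , p) = inj₂ (_ , p ◅◅ return ((uv , ≠) , refl))

        label : ∀ v → ∃ (Label v)
        label v with ⇝? (x , false) (v , false) | ⇝? (x , false) (v , true) | covered v
        ... | yes p | _     | _ = false , inj₁ p
        ... | no _  | yes p | _ = true , inj₁ p
        ... | no ¬p | no ¬q | inj₁ (false , p) = contradiction p ¬p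
        ... | no ¬p | no ¬q | inj₁ (true  , p) = contradiction p ¬q
        ... | no ¬p | no ¬q | inj₂ (a , p) = a , inj₂ ((λ { false → ¬p ; true → ¬q }) , p)

      -- A candidate 2-colouring of G without `xy`, defined for every pair of vertices so that
      -- `stubborn?` can test it.
      halves : Fin n → Bool
      halves v = proj₁ (label v)

      -- Two different labels of a vertex would come from walks of different parity with the same
      -- start, which close up to an odd walk avoiding `xy`.
      no-odd⇒bipartite : (∀ z a → ¬ Star (Lift (Without x y)) (z , a) (z , not a)) →
        BipartiteWithout x y halves
      no-odd⇒bipartite none {u} {v} uv ≠ = unique (proj₂ (label v)) (across (proj₂ (label u)))
        where
        across : ∀ {a} → Label u a → Label v (not a)
        across (inj₁ p) = inj₁ (p ◅◅ return ((uv , ≠) , refl))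
        across (inj₂ (¬p , q)) =
          inj₂ ((λ b p → ¬p (not b) (p ◅◅ return (without-sym {a = b} (uv , ≠) , refl))) ,
                q ◅◅ return ((uv , ≠) , refl))
        agree : ∀ {a b s} → s ⇝ (v , a) → s ⇝ (v , b) → a ≡ b
        agree {a} {b} p q with a ≟ᵇ b
        ... | yes eq = eq
        ... | no neq = contradiction
          (without-reverse (subst (λ c → _ ⇝ (v , c)) (¬-not neq) p) ◅◅ q)
          λ r → none v (not b) (subst (λ c → (v , not b) ⇝ (v , c)) (sym (not-involutive b)) r)
        unique : ∀ {a b} → Label v a → Label v b → a ≡ b
        unique (inj₁ p) (inj₁ q) = agree p q
        unique (inj₁ p) (inj₂ (¬p , _)) = contradiction p (¬p _)
        unique (inj₂ (¬p , _)) (inj₁ p) = contradiction p (¬p _)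
        unique (inj₂ (_ , p)) (inj₂ (_ , q)) = agree p q

    stubborn⇒bipartite : ∀ {x y} → Stubborn G x y → BipartiteWithout x y (halves x y)
    stubborn⇒bipartite stub = no-odd⇒bipartite _ _ (stubborn⇒no-odd stub)

    -- The condition on all odd closed walks reduces to a finite check: whether `halves` is proper
    -- away from `xy`.
    stubborn? : ∀ x y → Dec (Stubborn G x y)
    stubborn? x y with adj? x y
    ... | no ¬xy = no (¬xy ∘ proj₁)
    ... | yes xy with all? (λ u → all? λ v → ¬? (adj? u v ×-dec ¬? (sameEdge? u v x y) ×-dec
                               (halves x y u ≟ᵇ halves x y v)))
    ...   | yes ok = yes (bipartite⇒stubborn {f = halves x y} xy λ {u} {v} uv ≠ →
                          ¬-not λ eq → ok u v (uv , ≠ , sym eq))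
    ...   | no ¬ok = no λ stub → ¬ok λ u v (uv , ≠ , eq) →
                          not-¬ (sym eq) (stubborn⇒bipartite stub uv ≠)

  stubborn-sym : ∀ {x y} → Stubborn G x y → Stubborn G y x
  stubborn-sym {x} {y} (xy , uses) = adj-sym xy , λ u vs walk odd → flip-uses (u ∷ vs) (uses u vs walk odd)
    where
    flip-uses : ∀ vs → UsesEdge x y vs → UsesEdge y x vs
    flip-uses (_ ∷ _ ∷ _)  (here p)  = here (swap p)
    flip-uses (_ ∷ v ∷ vs) (there p) = there (flip-uses (v ∷ vs) p)

  bipartite-ends : ¬ Bipartite G → ∀ {x y f} → BipartiteWithout x y f → f x ≡ f y
  bipartite-ends nonbip {x} {y} {f} bip with f x ≟ᵇ f y
  ... | yes eq = eq
  ... | no neq = contradiction (f , proper) nonbip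
    where
    proper : ∀ u v → Adj G u v → f u ≢ f v
    proper u v uv eq with sameEdge? u v x y
    ... | yes (inj₁ (refl , refl)) = neq eq
    ... | yes (inj₂ (refl , refl)) = neq (sym eq)
    ... | no ≠ = not-¬ (sym eq) (bip uv ≠)

-- Colouring one more edge

Strong : {V : Set} → (V → V → Set) → Set
Strong R = ∀ s t → Star R s t

any-bool? : {P : Bool → Set} → (∀ b → Dec (P b)) → Dec (∃ P)
any-bool? P? with P? false | P? true
... | yes p | _     = yes (false , p)
... | no _  | yes p = yes (true , p)
... | no ¬p | no ¬q = no λ { (false , p) → ¬p p ; (true , p) → ¬q p }

-- E consists of the arcs away from the edge xy, which itself is still
-- traversable with both colours.
module ColourEdge {n : ℕ} {E : Fin n → Fin n → Bool → Set}
  (E-sym : ∀ {u v a} → E u v a → E v u a) (E? : ∀ u v a → Dec (E u v a))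
  (x y : Fin n)
  (strong : Strong (Lift λ u v a → E u v a ⊎ SameEdge u v x y)) where

  Coloured : Bool → Fin n → Fin n → Bool → Set
  Coloured b u v a = E u v a ⊎ (SameEdge u v x y × a ≡ b)

  coloured-sym : ∀ {b u v a} → Coloured b u v a → Coloured b v u a
  coloured-sym (inj₁ e)        = inj₁ (E-sym e)
  coloured-sym (inj₂ (s , eq)) = inj₂ (same-flipˡ s , eq)

  coloured? : ∀ b u v a → Dec (Coloured b u v a)
  coloured? b u v a = E? u v a ⊎-dec (sameEdge? u v x y ×-dec (a ≟ᵇ b))

  -- A single walk against the arcs of the newly coloured edge suffices:
  -- σ reverses it into one against the other lift of xy.
  coloured-strong : ∀ b → Star (Lift (Coloured b)) (y , not b) (x , b) → Strong (Lift (Coloured b))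
  coloured-strong b back s t = (arc ⋆) (strong s t)
    where
    back′ : Star (Lift (Coloured b)) (x , not b) (y , b)
    back′ = subst (λ c → Star (Lift (Coloured b)) (x , not b) (y , c)) (not-involutive b)
      (σ-reverse⋆ (coloured-sym {b}) back)
    arc : ∀ {s t} → Lift (λ u v a → E u v a ⊎ SameEdge u v x y) s t → Star (Lift (Coloured b)) s t
    arc (inj₁ e , eq) = return (inj₁ e , eq)
    arc {u , a} (inj₂ same , refl) with a ≟ᵇ b
    ... | yes refl = return (inj₂ (same , refl) , refl)
    ... | no neq with ¬-not neq | same
    ...   | refl | inj₁ (refl , refl) = subst (λ c → Star (Lift (Coloured b)) (u , not b) (y , c)) (sym (not-involutive b)) back′
    ...   | refl | inj₂ (refl , refl) = subst (λ c → Star (Lift (Coloured b)) (u , not b) (x , c)) (sym (not-involutive b)) back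

  private
    _⇝_ : State n → State n → Set
    _⇝_ = Star (Lift E)

    _⇝?_ : Decidable _⇝_
    _⇝?_ = lift-reachable? {E = E} E?

    dual : ∀ {s t} → s ⇝ t → σ t ⇝ σ s
    dual = σ-reverse⋆ {E = E} E-sym

    terminal : Bool → Bool → State n
    terminal false a = x , a
    terminal true  a = y , a

    x₀ = terminal false false
    x₁ = terminal false true
    y₀ = terminal true false
    y₁ = terminal true true

    hits? : ∀ z → Dec (∃[ i ] ∃[ a ] z ⇝ terminal i a)
    hits? z = any-bool? λ i → any-bool? λ a → z ⇝? terminal i a

    -- A set closed under `E` that meets no end of `xy` is closed under the arcs of `xy` too, so
    -- strong connectivity puts `x₀` into it after all.
    to-terminal : ∀ z → ∃[ i ] ∃[ a ] z ⇝ terminal i a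
    to-terminal z with hits? z
    ... | yes p = p
    ... | no ¬p = contradiction (preserve (z ⇝_) closed (strong z x₀) ε) λ p → ¬p (false , false , p)
      where
      closed : ∀ {s t} → Lift (λ u v a → E u v a ⊎ SameEdge u v x y) s t → z ⇝ s → z ⇝ t
      closed (inj₁ e , eq) p = p ◅◅ return (e , eq)
      closed {_ , a} (inj₂ (inj₁ (refl , _)) , _) p = contradiction (false , a , p) ¬p
      closed {_ , a} (inj₂ (inj₂ (refl , _)) , _) p = contradiction (true , a , p) ¬p

    from-terminal : ∀ z → ∃[ i ] ∃[ a ] terminal i a ⇝ z
    from-terminal (v , a) with to-terminal (v , not a)
    ... | false , b , p = false , not b , subst (λ c → (x , not b) ⇝ (v , c)) (not-involutive a) (dual p)
    ... | true  , b , p = true  , not b , subst (λ c → (y , not b) ⇝ (v , c)) (not-involutive a) (dual p)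

  -- A union of weak components of `E`: no arc enters or leaves it, and its trace on the four lifts
  -- of `x` and `y` is prescribed.
  Cut : (Bool → Bool → Bool) → Set
  Cut label = Σ (State n → Bool) λ C → (∀ {s t} → Lift E s t → C s ≡ C t) ×
    (∀ i a → C (terminal i a) ≡ label i a)

  private
    -- The states reachable from terminals labelled `true`. They are closed backwards as well
    -- because every state lies on a walk of `E` between terminals.
    cut : ∀ label → (∀ i a j b → label i a ≡ true → label j b ≡ false →
      ¬ (terminal i a ⇝ terminal j b) × ¬ (terminal j b ⇝ terminal i a)) → Cut label
    cut label separated = C , arc , at-terminal
      where
      Marked : State n → Set
      Marked z = ∃[ i ] ∃[ a ] (label i a ≡ true × terminal i a ⇝ z)
      marked? : ∀ z → Dec (Marked z)
      marked? z = any-bool? λ i → any-bool? λ a → (label i a ≟ᵇ true) ×-dec (terminal i a ⇝? z)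
      C : State n → Bool
      C z = does (marked? z)
      carry : ∀ {i a j b} → label i a ≡ true → terminal i a ⇝ terminal j b → label j b ≡ true
      carry {i} {a} {j} {b} l p with label j b ≟ᵇ true
      ... | yes eq = eq
      ... | no neq = contradiction p (proj₁ (separated i a j b l (¬-not neq)))
      carryᵒ : ∀ {i a j b} → label i a ≡ true → terminal j b ⇝ terminal i a → label j b ≡ true
      carryᵒ {i} {a} {j} {b} l p with label j b ≟ᵇ true
      ... | yes eq = eq
      ... | no neq = contradiction p (proj₂ (separated i a j b l (¬-not neq)))
      arc : ∀ {s t} → Lift E s t → C s ≡ C t
      arc {s} {t} r with marked? s | marked? t
      ... | yes _ | yes _ = refl
      ... | no _  | no _  = refl
      ... | yes (i , a , l , p) | no ¬q = contradiction (i , a , l , p ◅◅ return r) ¬q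
      -- A terminal before `s` reaches a terminal after `t`, and so does the terminal marking `t`.
      -- The label `true` passes forwards to the terminal after `t` and then back to the one before
      -- `s`.
      ... | no ¬p | yes (i , a , l , q) with from-terminal s | to-terminal t
      ...   | j , b , p | k , c , o =
        contradiction (j , b , carryᵒ (carry l (q ◅◅ o)) (p ◅◅ (r ◅ o)) , p) ¬p
      at-terminal : ∀ i a → C (terminal i a) ≡ label i a
      at-terminal i a with marked? (terminal i a) | label i a ≟ᵇ true
      ... | yes _ | yes l = sym l
      ... | yes (_ , _ , l , p) | no ¬l = contradiction (carry l p) ¬l
      ... | no ¬m | yes l = contradiction (i , a , l , ε) ¬m
      ... | no _  | no ¬l = sym (¬-not ¬l)

    -- The lifts of `xy` link `x₀` with `y₁` and `x₁` with `y₀`. A walk from the first pair to the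
    -- second must cross by arcs of `E`, and up to `σ` there are three ways.
    crossing : x₀ ⇝ y₀ ⊎ x₀ ⇝ x₁ ⊎ y₁ ⇝ y₀
    crossing with x₀ ⇝? y₀ | x₀ ⇝? x₁ | y₁ ⇝? y₀
    ... | yes p | _ | _ = inj₁ p
    ... | no _ | yes p | _ = inj₂ (inj₁ p)
    ... | no _ | no _ | yes p = inj₂ (inj₂ p)
    ... | no ¬γ | no ¬α | no ¬β = contradiction (preserve Z closed (strong x₀ x₁) (inj₁ ε))
      [ ¬α , ¬γ ∘ dual ]
      where
      Z : State n → Set
      Z t = x₀ ⇝ t ⊎ y₁ ⇝ t
      closed : ∀ {s t} → Lift (λ u v a → E u v a ⊎ SameEdge u v x y) s t → Z s → Z t
      closed (inj₁ e , eq) (inj₁ p) = inj₁ (p ◅◅ return (e , eq))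
      closed (inj₁ e , eq) (inj₂ p) = inj₂ (p ◅◅ return (e , eq))
      closed {_ , false} (inj₂ (inj₁ (refl , refl)) , refl) _ = inj₂ ε
      closed {_ , true}  (inj₂ (inj₁ (refl , refl)) , refl) z = contradiction z [ ¬α , ¬γ ∘ dual ]
      closed {_ , false} (inj₂ (inj₂ (refl , refl)) , refl) z = contradiction z [ ¬γ , ¬β ]
      closed {_ , true}  (inj₂ (inj₂ (refl , refl)) , refl) _ = inj₁ ε

    crossingᵒ : y₀ ⇝ x₀ ⊎ x₁ ⇝ x₀ ⊎ y₀ ⇝ y₁
    crossingᵒ with y₀ ⇝? x₀ | x₁ ⇝? x₀ | y₀ ⇝? y₁
    ... | yes p | _ | _ = inj₁ p
    ... | no _ | yes p | _ = inj₂ (inj₁ p)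
    ... | no _ | no _ | yes p = inj₂ (inj₂ p)
    ... | no ¬γ | no ¬α | no ¬β = contradiction (preserve Z closed (strong x₁ x₀) (inj₁ ε))
      [ ¬α , ¬γ ]
      where
      Z : State n → Set
      Z t = x₁ ⇝ t ⊎ y₀ ⇝ t
      closed : ∀ {s t} → Lift (λ u v a → E u v a ⊎ SameEdge u v x y) s t → Z s → Z t
      closed (inj₁ e , eq) (inj₁ p) = inj₁ (p ◅◅ return (e , eq))
      closed (inj₁ e , eq) (inj₂ p) = inj₂ (p ◅◅ return (e , eq))
      closed {_ , true}  (inj₂ (inj₁ (refl , refl)) , refl) _ = inj₂ ε
      closed {_ , false} (inj₂ (inj₁ (refl , refl)) , refl) z = contradiction z [ ¬α , ¬γ ]
      closed {_ , true}  (inj₂ (inj₂ (refl , refl)) , refl) z = contradiction z [ ¬γ ∘ dual , ¬β ]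
      closed {_ , false} (inj₂ (inj₂ (refl , refl)) , refl) _ = inj₁ ε

  -- `labelS` takes one lift of each end, so the cut splits the whole cover and `xy` is stubborn.
  -- `labelX` and `labelY` take a single lift of one end, whose side is then pendant.
  labelS labelX labelY : Bool → Bool → Bool
  labelS i     a = not a
  labelX false a = not a
  labelX true  a = false
  labelY false a = false
  labelY true  a = not a

  -- If both colours fail, `E` has no walk between `x₀` and `y₁` nor between `x₁` and `y₀`. A
  -- `crossing` and a `crossingᵒ` then either compose to an excluded walk or separate the terminals
  -- in one of three ways.
  colour-or-cut : (∃[ b ] Strong (Lift (Coloured b))) ⊎ Cut labelS ⊎ Cut labelX ⊎ Cut labelY
  colour-or-cut
    with lift-reachable? {E = Coloured false} (coloured? false) y₁ x₀
       | lift-reachable? {E = Coloured true} (coloured? true) y₀ x₁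
  ... | yes p | _     = inj₁ (false , coloured-strong false p)
  ... | no _  | yes p = inj₁ (true , coloured-strong true p)
  ... | no ¬p | no ¬q = inj₂ (cases crossing crossingᵒ)
    where
    keep : ∀ {b s t} → s ⇝ t → Star (Lift (Coloured b)) s t
    keep = gmap id λ { (e , eq) → inj₁ e , eq }
    ¬y₁x₀ : ¬ (y₁ ⇝ x₀)
    ¬y₁x₀ = ¬p ∘ keep
    ¬x₁y₀ : ¬ (x₁ ⇝ y₀)
    ¬x₁y₀ = ¬y₁x₀ ∘ dual
    ¬y₀x₁ : ¬ (y₀ ⇝ x₁)
    ¬y₀x₁ = ¬q ∘ keep
    ¬x₀y₁ : ¬ (x₀ ⇝ y₁)
    ¬x₀y₁ = ¬y₀x₁ ∘ dual
    ¬β′α′ : y₁ ⇝ y₀ → x₁ ⇝ x₀ → ⊥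
    -- The arc of colour `false` from `y₀` to `x₁` would join the two walks into the one whose
    -- absence rules out this colour.
    ¬β′α′ p q = ¬p (keep p ◅◅ (inj₂ (inj₂ (refl , refl) , refl) , refl) ◅ keep q)
    ¬βα : y₀ ⇝ y₁ → x₀ ⇝ x₁ → ⊥
    ¬βα p q = ¬q (keep p ◅◅ (inj₂ (inj₂ (refl , refl) , refl) , refl) ◅ keep q)
    cases : x₀ ⇝ y₀ ⊎ x₀ ⇝ x₁ ⊎ y₁ ⇝ y₀ → y₀ ⇝ x₀ ⊎ x₁ ⇝ x₀ ⊎ y₀ ⇝ y₁ →
      Cut labelS ⊎ Cut labelX ⊎ Cut labelY
    cases (inj₁ γ) (inj₁ γ′) = inj₁ (cut labelS λ
      { false false false true _ _ → (λ p → ¬y₀x₁ (γ′ ◅◅ p)) , (λ p → ¬x₁y₀ (p ◅◅ γ))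
      ; false false true  true _ _ → ¬x₀y₁ , ¬y₁x₀
      ; true  false false true _ _ → ¬y₀x₁ , ¬x₁y₀
      ; true  false true  true _ _ → (λ p → ¬x₀y₁ (γ ◅◅ p)) , (λ p → ¬y₁x₀ (p ◅◅ γ′)) })
    cases (inj₁ γ) (inj₂ (inj₁ α′)) = contradiction (α′ ◅◅ γ) ¬x₁y₀
    cases (inj₁ γ) (inj₂ (inj₂ β)) = contradiction (γ ◅◅ β) ¬x₀y₁
    cases (inj₂ (inj₁ α)) (inj₁ γ′) = contradiction (γ′ ◅◅ α) ¬y₀x₁
    cases (inj₂ (inj₁ α)) (inj₂ (inj₁ α′)) = inj₂ (inj₂ (cut labelY λ
      { true false false false _ _ → (λ p → ¬y₀x₁ (p ◅◅ α)) , (λ p → ¬x₁y₀ (α′ ◅◅ p))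
      ; true false false true  _ _ → ¬y₀x₁ , ¬x₁y₀
      ; true false true  true  _ _ → (λ p → ¬βα p α) , (λ p → ¬β′α′ p α′) }))
    cases (inj₂ (inj₁ α)) (inj₂ (inj₂ β)) = ⊥-elim (¬βα β α)
    cases (inj₂ (inj₂ β′)) (inj₁ γ′) = contradiction (β′ ◅◅ γ′) ¬y₁x₀
    cases (inj₂ (inj₂ β′)) (inj₂ (inj₁ α′)) = ⊥-elim (¬β′α′ β′ α′)
    cases (inj₂ (inj₂ β′)) (inj₂ (inj₂ β)) = inj₂ (inj₁ (cut labelX λ
      { false false false true  _ _ → ¬βα β , ¬β′α′ β′
      ; false false true  false _ _ → (λ p → ¬x₀y₁ (p ◅◅ β)) , (λ p → ¬y₁x₀ (β′ ◅◅ p))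
      ; false false true  true  _ _ → ¬x₀y₁ , ¬y₁x₀ }))

-- Colouring all edges but the unavoidable ones

module _ {n : ℕ} (G : Graph n) where

  PartialColouring : Set
  PartialColouring = Fin n → Fin n → Maybe Bool

  Allowed : Maybe Bool → Bool → Set
  Allowed nothing  a = ⊤
  Allowed (just b) a = a ≡ b

  allowed? : ∀ m a → Dec (Allowed m a)
  allowed? nothing  a = yes tt
  allowed? (just b) a = a ≟ᵇ b

  Allow : PartialColouring → Fin n → Fin n → Bool → Set
  Allow col u v a = Adj G u v × Allowed (col u v) a

  allow? : ∀ col u v a → Dec (Allow col u v a)
  allow? col u v a = adj? G u v ×-dec allowed? (col u v) a

  IsStateCut : Fin n → Fin n → (State n → Bool) → Set
  IsStateCut x y C = ∀ {u v} a → Adj G u v → ¬ SameEdge u v x y → C (u , a) ≡ C (v , not a)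

  -- xy is a bridge, the side of y is bipartite, and C is the copy containing
  -- (y , false) of that side in the double cover.
  record Pendant (x y : Fin n) : Set where
    field
      C        : State n → Bool
      isCut    : IsStateCut x y C
      at-y     : C (y , false) ≡ true
      at-σy    : C (y , true) ≡ false
      at-x     : ∀ a → C (x , a) ≡ false

  Unavoidable : Fin n → Fin n → Set
  Unavoidable x y = Stubborn G x y ⊎ Pendant x y ⊎ Pendant y x

  module _ (connected : Connected G) (nonbipartite : ¬ Bipartite G) where

    root : Fin n
    root = go n G nonbipartite
      where
      go : ∀ m (G : Graph m) → ¬ Bipartite G → Fin m
      go zero    G nb = ⊥-elim (nb ((λ ()) , λ ()))
      go (suc m) G nb = zero

    -- Uncoloured arcs are reversible, so only connectedness is at stake. Without an odd closed walk
    -- at `root`, the states reachable from it would give a bipartition.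
    cover-strong : Strong (Lift λ u v (_ : Bool) → Adj G u v)
    cover-strong s t = back (to-root s) ◅◅ to-root t
      where
      E : Fin n → Fin n → Bool → Set
      E u v _ = Adj G u v
      _⇝_ = Star (Lift E)
      ⇝? = lift-reachable? {E = E} λ u v _ → adj? G u v
      back : ∀ {s t} → s ⇝ t → t ⇝ s
      back = reverse λ { {u , a} {v , b} (e , eq) →
        adj-sym G e , trans (sym (not-involutive a)) (cong not (sym eq)) }
      some : ∀ v → ∃[ a ] (root , false) ⇝ (v , a)
      some v = preserve (λ v → ∃[ a ] (root , false) ⇝ (v , a))
        (λ { uv (a , p) → not a , p ◅◅ return (uv , refl) }) (star-adj G connected root v) (false , ε)
      odd : (root , false) ⇝ (root , true)
      odd with ⇝? (root , false) (root , true)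
      ... | yes p = p
      ... | no ¬p = contradiction (f , proper) nonbipartite
        where
        f : Fin n → Bool
        f v = does (⇝? (root , false) (v , false))
        proper : ∀ u v → Adj G u v → f u ≢ f v
        proper u v uv eq with ⇝? (root , false) (u , false) | ⇝? (root , false) (v , false)
        proper u v uv () | yes _ | no _
        proper u v uv () | no _  | yes _
        proper u v uv _  | yes p | yes q =
          ¬p (p ◅◅ (uv , refl) ◅ σ-reverse⋆ {E = E} (adj-sym G) q)
        proper u v uv _  | no ¬p₀ | no ¬q₀ with some u
        ... | false , p = ¬p₀ p
        ... | true  , p = ¬q₀ (p ◅◅ return (uv , refl))
      to-root : ∀ t → (root , false) ⇝ t
      to-root (v , b) with some v
      ... | a , p with a ≟ᵇ b
      ...   | yes refl = p
      ...   | no neq = subst (λ c → (root , false) ⇝ (v , c)) (sym (¬-not (neq ∘ sym)))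
                         (odd ◅◅ back (σ-reverse⋆ {E = E} (adj-sym G) p))

    cover-constant : {A : Set} (k : State n → A) →
      (∀ {u v} a → Adj G u v → k (u , a) ≡ k (v , not a)) → ∀ s t → k s ≡ k t
    cover-constant k eq s t =
      constant k (λ { {_ , a} (uv , refl) → eq a uv }) (cover-strong s t)

    -- Whether `C` contains exactly one lift of a vertex is invariant along all edges, even `xy`,
    -- and true at `x`. So it is true everywhere, and membership in `C` is a proper 2-colouring away
    -- from `xy`.
    split-cut⇒stubborn : ∀ {x y C} → Adj G x y → IsStateCut x y C →
      (∀ a → C (x , a) ≡ not a) → (∀ a → C (y , a) ≡ not a) → Stubborn G x y
    split-cut⇒stubborn {x} {y} {C} xy isCut at-x at-y =
      bipartite⇒stubborn G {f = λ v → C (v , true)} xy λ {u} {v} uv ≠ →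
        trans (sym (isCut false uv ≠)) (complementary u)
      where
      k : State n → Bool
      k (v , a) = C (v , a) xor C (v , not a)
      flip : ∀ a → not a xor not (not a) ≡ not (not a) xor not (not (not a))
      flip false = refl
      flip true  = refl
      k-const : ∀ {u v} a → Adj G u v → k (u , a) ≡ k (v , not a)
      k-const {u} {v} a uv with sameEdge? u v x y
      ... | yes (inj₁ (refl , refl)) rewrite at-x a | at-x (not a) | at-y (not a) | at-y (not (not a)) = flip a
      ... | yes (inj₂ (refl , refl)) rewrite at-y a | at-y (not a) | at-x (not a) | at-x (not (not a)) = flip a
      ... | no ≠ = cong₂ _xor_ (isCut a uv ≠) (isCut (not a) uv ≠)
      complementary : ∀ u → C (u , false) ≡ not (C (u , true))
      complementary u with C (u , false) | C (u , true) | cover-constant k k-const (u , false) (x , false)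
      ... | p | q | eq rewrite at-x false | at-x true = solve p q eq
        where
        solve : ∀ p q → p xor q ≡ true → p ≡ not q
        solve true  true  ()
        solve true  false _ = refl
        solve false true  _ = refl
        solve false false ()

    Settled : PartialColouring → Fin n → Fin n → Set
    Settled col x y = (∃[ b ] col x y ≡ just b) ⊎ Unavoidable x y

    record Maximal (pairs : List (Fin n × Fin n)) : Set where
      field
        col        : PartialColouring
        col-sym    : ∀ u v → col u v ≡ col v u
        col-strong : Strong (Lift (Allow col))
        settled    : All (λ (x , y) → Adj G x y → Settled col x y) pairs

    -- Greedy: an edge is coloured whenever this keeps the cover strong. `Unavoidable` refers to `G`
    -- alone, so it survives the colouring of further edges.
    maximal : ∀ pairs → Maximal pairs
    maximal [] = record
      { col = λ _ _ → nothing ; col-sym = λ _ _ → refl ; settled = []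
      ; col-strong = λ s t → gmap id (λ { (uv , eq) → (uv , tt) , eq }) (cover-strong s t) }
    maximal ((x , y) ∷ pairs) with maximal pairs
    ... | record { col = col ; col-sym = col-sym ; col-strong = col-strong ; settled = settled }
      with adj? G x y | col x y in colxy
    ... | no ¬xy | _ = record { col-sym = col-sym ; col-strong = col-strong
                              ; settled = (λ xy → contradiction xy ¬xy) ∷ settled }
    ... | yes xy | just b = record { col-sym = col-sym ; col-strong = col-strong
                                   ; settled = (λ _ → inj₁ (b , colxy)) ∷ settled }
    ... | yes xy | nothing = extend colour-or-cut
      where
      E : Fin n → Fin n → Bool → Set
      E u v a = Allow col u v a × ¬ SameEdge u v x y
      E-sym : ∀ {u v a} → E u v a → E v u a
      E-sym {u} {v} {a} ((uv , ok) , ≠) =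
        (adj-sym G uv , subst (λ m → Allowed m a) (col-sym u v) ok) , ≠ ∘ same-flipˡ
      free : Strong (Lift λ u v a → E u v a ⊎ SameEdge u v x y)
      free s t = gmap id arc (col-strong s t)
        where
        arc : ∀ {s t} → Lift (Allow col) s t → Lift (λ u v a → E u v a ⊎ SameEdge u v x y) s t
        arc {u , a} {v , b} (ok , eq) with sameEdge? u v x y
        ... | yes same = inj₂ same , eq
        ... | no ≠     = inj₁ (ok , ≠) , eq
      open ColourEdge {E = E} (λ {u} {v} {a} → E-sym {u} {v} {a})
        (λ u v a → allow? col u v a ×-dec ¬? (sameEdge? u v x y)) x y free
      isCut : ∀ {C} → (∀ {s t} → Lift E s t → C s ≡ C t) → IsStateCut x y C
      isCut {C} const {u} {v} a uv ≠ with col u v in eq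
      ... | nothing = const ((((uv , subst (λ m → Allowed m a) (sym eq) tt) , ≠)) , refl)
      ... | just b with a ≟ᵇ b
      ...   | yes refl = const ((((uv , subst (λ m → Allowed m a) (sym eq) refl) , ≠)) , refl)
      -- This arc has the wrong colour, but the opposite one, from `(v , not a)` to `(u , a)` with
      -- colour `not a`, is available, and a cut ignores direction.
      ...   | no neq = sym (const (((adj-sym G uv ,
                subst (λ m → Allowed m (not a)) (trans (sym eq) (col-sym u v)) (sym (¬-not (neq ∘ sym)))) ,
                ≠ ∘ same-flipˡ) , sym (not-involutive a)))
      extend : _ → Maximal ((x , y) ∷ pairs)
      extend (inj₁ (b , strong)) = record
        { col = col′ ; col-sym = col′-sym
        ; col-strong = λ s t → gmap id arc (strong s t)
        ; settled = (λ _ → inj₁ (b , at-xy)) ∷ All.map (λ {p} → keep p) settled }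
        where
        col′ : PartialColouring
        col′ u v = if does (sameEdge? u v x y) then just b else col u v
        on : ∀ {u v} → SameEdge u v x y → col′ u v ≡ just b
        on {u} {v} same = cong (λ d → if d then just b else col u v) (dec-true (sameEdge? u v x y) same)
        off : ∀ {u v} → ¬ SameEdge u v x y → col′ u v ≡ col u v
        off {u} {v} ≠ = cong (λ d → if d then just b else col u v) (dec-false (sameEdge? u v x y) ≠)
        at-xy : col′ x y ≡ just b
        at-xy = on (inj₁ (refl , refl))
        col′-sym : ∀ u v → col′ u v ≡ col′ v u
        col′-sym u v with sameEdge? u v x y
        ... | yes same = trans (on same) (sym (on (same-flipˡ same)))
        ... | no ≠ = trans (off ≠) (trans (col-sym u v) (sym (off (≠ ∘ same-flipˡ))))
        arc : ∀ {s t} → Lift (Coloured b) s t → Lift (Allow col′) s t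
        arc {u , a} (inj₁ ((uv , ok) , ≠) , eq) = (uv , subst (λ m → Allowed m a) (sym (off ≠)) ok) , eq
        arc {u , a} {v , _} (inj₂ (same , refl) , eq) = (adj same , subst (λ m → Allowed m a) (sym (on same)) refl) , eq
          where
          adj : SameEdge u v x y → Adj G u v
          adj (inj₁ (refl , refl)) = xy
          adj (inj₂ (refl , refl)) = adj-sym G xy
        keep : ∀ (p : Fin n × Fin n) → (Adj G (proj₁ p) (proj₂ p) → Settled col (proj₁ p) (proj₂ p)) →
          Adj G (proj₁ p) (proj₂ p) → Settled col′ (proj₁ p) (proj₂ p)
        keep (u , v) done uv with done uv
        ... | inj₂ un = inj₂ un
        ... | inj₁ (b′ , eq) with sameEdge? u v x y
        ...   | yes same = inj₁ (b , on same)
        ...   | no ≠ = inj₁ (b′ , trans (off ≠) eq)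
      extend (inj₂ rest) = record
        { col-sym = col-sym ; col-strong = col-strong ; settled = (λ _ → inj₂ (unavoidable rest)) ∷ settled }
        where
        unavoidable : _ → Unavoidable x y
        unavoidable (inj₁ (C , const , at)) =
          inj₁ (split-cut⇒stubborn {C = C} xy (isCut {C} const) (at false) (at true))
        unavoidable (inj₂ (inj₁ (C , const , at))) = inj₂ (inj₂ record
          { C = C ; isCut = λ a uv ≠ → isCut {C} const a uv (≠ ∘ same-flipʳ)
          ; at-y = at false false ; at-σy = at false true ; at-x = at true })
        unavoidable (inj₂ (inj₂ (C , const , at))) = inj₂ (inj₁ record
          { C = C ; isCut = isCut {C} const
          ; at-y = at true false ; at-σy = at true true ; at-x = at false })

-- Walks avoiding the wrong direction of bridges

module Reorient {V : Set} (_≟_ : DecidableEquality V) {R Good : V → V → Set}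
  (Bad : V → V → (V → Bool) → Set)
  (bad-cut : ∀ {u w h} → Bad u w h → h u ≢ h w × (∀ {a b} → R a b →
    h a ≡ h b ⊎ (a ≡ u × b ≡ w) ⊎ (a ≡ w × b ≡ u)))
  (classify : ∀ {u w} → R u w → Good u w ⊎ ∃ (Bad u w)) where

  Visits : ∀ {s t} → V → Star R s t → Set
  Visits z (ε {x})           = z ≡ x
  Visits z (_◅_ {x} _ p)     = z ≡ x ⊎ Visits z p

  Simple : ∀ {s t} → Star R s t → Set
  Simple ε             = ⊤
  Simple (_◅_ {x} _ p) = ¬ Visits x p × Simple p

  visits? : ∀ {s t} z (p : Star R s t) → Dec (Visits z p)
  visits? z (ε {x})       = z ≟ x
  visits? z (_◅_ {x} _ p) = (z ≟ x) ⊎-dec visits? z p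

  visits-source : ∀ {s t} (p : Star R s t) → Visits s p
  visits-source ε       = refl
  visits-source (_ ◅ _) = inj₁ refl

  suffix : ∀ {s t z} (p : Star R s t) → Simple p → Visits z p → Σ (Star R z t) Simple
  suffix ε       simple       refl        = ε , tt
  suffix (r ◅ p) simple       (inj₁ refl) = r ◅ p , simple
  suffix (r ◅ p) (_ , simple) (inj₂ v)    = suffix p simple v

  simplify : ∀ {s t} → Star R s t → Σ (Star R s t) Simple
  simplify ε = ε , tt
  simplify {s} (r ◅ p) with simplify p
  ... | q , simple with visits? s q
  ...   | yes v = suffix q simple v
  ...   | no ¬v = r ◅ q , ¬v , simple

  visits-crossing : ∀ {z} {h : V → Bool} → (∀ {a b} → R a b → h a ≡ h b ⊎ a ≡ z ⊎ b ≡ z) →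
    ∀ {s t} (p : Star R s t) → h s ≢ h t → Visits z p
  visits-crossing only ε neq = contradiction refl neq
  visits-crossing only (r ◅ p) neq with only r
  ... | inj₁ eq          = inj₂ (visits-crossing only p (neq ∘ trans eq))
  ... | inj₂ (inj₁ refl) = inj₁ refl
  ... | inj₂ (inj₂ refl) = inj₂ (visits-source p)

  Compatible : V → V → Set
  Compatible s t = ∀ {u w h} → Bad u w h → h s ≡ h u → h t ≢ h w

  -- A simple walk crosses each bridge at most once, hence only in the
  -- direction from its source to its target.
  reorient : ∀ {s t} → Compatible s t → Star R s t → Star Good s t
  reorient compatible p with simplify p
  ... | q , simple = go q simple compatible
    where
    ends : ∀ {u w h z} → Bad u w h → z ≡ u ⊎ z ≡ w → ∀ {a b} → R a b → h a ≡ h b ⊎ a ≡ z ⊎ b ≡ z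
    ends bad at r with at | proj₂ (bad-cut bad) r
    ... | _ | inj₁ eq = inj₁ eq
    ... | inj₁ refl | inj₂ (inj₁ (a , _)) = inj₂ (inj₁ a)
    ... | inj₁ refl | inj₂ (inj₂ (_ , b)) = inj₂ (inj₂ b)
    ... | inj₂ refl | inj₂ (inj₁ (_ , b)) = inj₂ (inj₂ b)
    ... | inj₂ refl | inj₂ (inj₂ (a , _)) = inj₂ (inj₁ a)
    go : ∀ {s t} (p : Star R s t) → Simple p → Compatible s t → Star Good s t
    go ε _ _ = ε
    go {s} {t} (_◅_ {j = w} r p) (fresh , simple) compatible with classify r
    ... | inj₂ (h , bad) = contradiction
      (visits-crossing (ends bad (inj₁ refl)) p (compatible bad refl ∘ sym)) fresh
    -- The rest stays compatible: if the first arc reverses a bad one and the end of the walk lay on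
    -- the side just left, the walk would have to revisit its source.
    ... | inj₁ good = good ◅ go p simple λ {u′} {w′} {h} bad eq eq′ →
      case proj₂ (bad-cut bad) r of λ
        { (inj₁ same) → compatible bad (trans same eq) eq′
        ; (inj₂ (inj₁ (refl , refl))) → proj₁ (bad-cut bad) (sym eq)
        ; (inj₂ (inj₂ (refl , refl))) → fresh
            (visits-crossing (ends bad (inj₂ refl)) p (λ e → proj₁ (bad-cut bad) (trans e eq′))) }

-- Colourings

module _ {n : ℕ} where

  -- `choose` may differ on `uv` and `vu`; the choice made from the smaller vertex is used for both.
  symmetric-choice : {R : Fin n → Fin n → Set} → Decidable R → (∀ {u v} → R u v → R v u) →
    (P : Fin n → Fin n → Bool → Set) → (∀ {u v k} → P u v k → P v u k) →
    (∀ {u v} → R u v → ∃ (P u v)) →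
    Σ (Fin n → Fin n → Bool) λ k → (∀ u v → k u v ≡ k v u) × (∀ {u v} → R u v → P u v (k u v))
  symmetric-choice {R} R? R-sym P P-sym choose = k , k-sym , k-good
    where
    k₀ : Fin n → Fin n → Bool
    k₀ u v with R? u v
    ... | yes r = proj₁ (choose r)
    ... | no _  = false
    k₀-good : ∀ {u v} → R u v → P u v (k₀ u v)
    k₀-good {u} {v} r with R? u v
    ... | yes r′ = proj₂ (choose r′)
    ... | no ¬r  = contradiction r ¬r
    k : Fin n → Fin n → Bool
    k u v with <-cmp u v
    ... | tri< _ _ _ = k₀ u v
    ... | tri≈ _ _ _ = k₀ u v
    ... | tri> _ _ _ = k₀ v u
    k-sym : ∀ u v → k u v ≡ k v u
    k-sym u v with <-cmp u v | <-cmp v u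
    ... | tri< lt _ _ | tri< gt _ _  = contradiction gt (<-asym lt)
    ... | tri< _ ≠ _  | tri≈ _ eq _  = contradiction (sym eq) ≠
    ... | tri< _ _ _  | tri> _ _ _   = refl
    ... | tri≈ _ eq _ | tri< _ ≠ _   = contradiction (sym eq) ≠
    ... | tri≈ _ refl _ | tri≈ _ _ _ = refl
    ... | tri≈ _ eq _ | tri> _ ≠ _   = contradiction (sym eq) ≠
    ... | tri> _ _ _  | tri< _ _ _   = refl
    ... | tri> _ ≠ _  | tri≈ _ eq _  = contradiction (sym eq) ≠
    ... | tri> _ _ gt | tri> _ _ lt  = contradiction gt (<-asym lt)
    k-good : ∀ {u v} → R u v → P u v (k u v)
    k-good {u} {v} r with <-cmp u v
    ... | tri< _ _ _ = k₀-good r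
    ... | tri≈ _ _ _ = k₀-good r
    ... | tri> _ _ _ = P-sym (k₀-good (R-sym r))

module _ {n : ℕ} (G : Graph n) where

  Alternating : (Fin n → Fin n → Bool) → State n → State n → Set
  Alternating k = Lift λ u v a → Adj G u v × k u v ≡ a

  ProperColouring : Set
  ProperColouring = Σ Colouring λ c → IsColouring c × ProperlyConnected G c

  properly-connected : (k : Fin n → Fin n → Bool) → (∀ u v → k u v ≡ k v u) →
    (∀ u v → ∃[ a ] ∃[ b ] Star (Alternating k) (u , a) (v , b)) → ProperColouring
  properly-connected k k-sym reach = c , (λ u v → cong toFin (k-sym u v)) , connect
    where
    toFin : Bool → Fin 2
    toFin false = zero
    toFin true  = suc zero
    c : Colouring
    c u v = toFin (k u v)
    toFin-injective : ∀ {a b} → toFin a ≡ toFin b → a ≡ b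
    toFin-injective {false} {false} _ = refl
    toFin-injective {true}  {true}  _ = refl
    StartsWith : Bool → Fin n → List (Fin n) → Set
    StartsWith a u []      = ⊤
    StartsWith a u (w ∷ _) = k u w ≡ a
    walk : ∀ {u a v b} → Star (Alternating k) (u , a) (v , b) →
      ∃[ vs ] (WalkFrom (Adj G) u vs v × ProperlyColoured c (u ∷ vs) × StartsWith a u vs)
    walk ε = [] , stop _ , pc1 _ , tt
    walk (((uw , eq) , refl) ◅ p) with walk p
    ... | [] , w , _ , _ = _ , step uw w , pc2 _ _ , eq
    ... | x ∷ vs , w , pc , start = _ , step uw w ,
      pc3 (λ same → not-¬ {x = k _ x} (trans (toFin-injective (sym same)) eq) start) pc , eq
    connect : ProperlyConnected G c
    connect u v with reach u v
    ... | a , b , p with walk p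
    ...   | vs , w , pc , _ = vs , w , pc

-- Graphs without stubborn edges

least : {P : ℕ → Set} → (∀ k → Dec (P k)) → ∀ k → P k → ∃[ m ] (P m × (∀ j → P j → m ≤ j))
least P? zero p = zero , p , λ _ _ → z≤n
least P? (suc k) p with P? zero
... | yes p₀ = zero , p₀ , λ _ _ → z≤n
... | no ¬p₀ with least (P? ∘ suc) k p
...   | m , q , minimal = suc m , q , λ { zero p₀ → contradiction p₀ ¬p₀ ; (suc j) r → s≤s (minimal j r) }

module _ {n : ℕ} (G : Graph n) (connected : Connected G) where

  distance : ∀ r → Σ (Fin n → ℕ) λ d → ∀ v → v ≡ r ⊎ ∃[ w ] (Adj G v w × suc (d w) ≡ d v)
  distance r = d , descend
    where
    Within : ℕ → Fin n → Set
    Within zero    v = v ≡ r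
    Within (suc k) v = ∃[ w ] (Adj G v w × Within k w)
    within? : ∀ k v → Dec (Within k v)
    within? zero    v = v ≟ᶠ r
    within? (suc k) v = any? λ w → adj? G v w ×-dec within? k w
    some : ∀ {v} → Star (Adj G) v r → ∃[ k ] Within k v
    some ε = zero , refl
    some (vw ◅ p) with some p
    ... | k , q = suc k , _ , vw , q
    shortest : ∀ v → ∃[ k ] (Within k v × (∀ j → Within j v → k ≤ j))
    shortest v = least (λ k → within? k v) _ (proj₂ (some (star-adj G connected v r)))
    d : Fin n → ℕ
    d v = proj₁ (shortest v)
    descend : ∀ v → v ≡ r ⊎ ∃[ w ] (Adj G v w × suc (d w) ≡ d v)
    descend v with shortest v
    ... | zero  , eq , _ = inj₁ eq
    ... | suc k , (w , vw , p) , minimal = inj₂ (w , vw , ≤-antisym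
      (s≤s (proj₂ (proj₂ (shortest w)) k p)) (minimal (suc (d w)) (w , vw , proj₁ (proj₂ (shortest w)))))

module _ {n : ℕ} (G : Graph n) (connected : Connected G) (nonbipartite : ¬ Bipartite G) where

  -- Having both lifts in `C` is invariant along all edges, including `xy`, and fails at `x`.
  pendant-exclusive : ∀ {x y} (P : Pendant G x y) → let open Pendant P in
    ∀ v a → C (v , a) ≡ true → C (v , not a) ≡ false
  pendant-exclusive {x} {y} P v a marked =
    trans (cong (_∧ C (v , not a)) (sym marked)) (trans (cover-constant G connected nonbipartite k k-const (v , a) (x , a)) at-k)
    where
    open Pendant P
    k : State n → Bool
    k (v , a) = C (v , a) ∧ C (v , not a)
    at-k : ∀ {a} → k (x , a) ≡ false
    at-k {a} rewrite at-x a = refl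
    at-ky : ∀ a → k (y , a) ≡ false
    at-ky false rewrite at-y | at-σy = refl
    at-ky true  rewrite at-y | at-σy = refl
    k-const : ∀ {u v} a → Adj G u v → k (u , a) ≡ k (v , not a)
    k-const {u} {v} a uv with sameEdge? u v x y
    ... | yes (inj₁ (refl , refl)) = trans at-k (sym (at-ky (not a)))
    ... | yes (inj₂ (refl , refl)) = trans (at-ky a) (sym at-k)
    ... | no ≠ = cong₂ _∧_ (isCut a uv ≠) (isCut (not a) uv ≠)

  private
    r : Fin n
    r = root G connected nonbipartite

    d : Fin n → ℕ
    d = proj₁ (distance G connected r)

    f : Fin n → Bool
    f v = parity (d v)

    parent : ∀ v → v ≡ r ⊎ ∃[ w ] (Adj G v w × suc (d w) ≡ d v)
    parent = proj₂ (distance G connected r)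

  -- Distances to any vertex alternate along the edges of a pendant bipartite side.
  module _ {x y : Fin n} (P : Pendant G x y) where

    open Pendant P

    private
      f-parent : ∀ {v w} → suc (d w) ≡ d v → f v ≡ not (f w)
      f-parent eq = cong parity (sym eq)

      move : ∀ {a b c e} → not a xor b ≡ c → e ≡ not b → a xor e ≡ c
      move {false} refl refl = refl
      move {true}  refl refl = not-involutive _

    -- Parents lead towards `r` and leave the side only across the bridge, at `y`; each step flips
    -- both the parity and the state. The induction runs on the distance `m`.
    parity-outside : (∀ b → C (r , b) ≡ false) → ∀ m v a → d v ≡ m → C (v , a) ≡ true →
      a xor f v ≡ f y
    parity-outside r∉ m v a eq marked with parent v
    ... | inj₁ refl = contradiction (trans (sym marked) (r∉ a)) λ ()
    parity-outside r∉ zero v a eq marked | inj₂ (w , vw , eq′) = contradiction (trans eq′ eq) λ ()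
    parity-outside r∉ (suc m) v a eq marked | inj₂ (w , vw , eq′) with sameEdge? v w x y
    ... | yes (inj₁ (refl , refl)) = contradiction (trans (sym marked) (at-x a)) λ ()
    parity-outside r∉ (suc m) v true eq marked | inj₂ (w , vw , eq′) | yes (inj₂ (refl , refl)) =
      contradiction (trans (sym marked) at-σy) λ ()
    parity-outside r∉ (suc m) v false eq marked | inj₂ (w , vw , eq′) | yes (inj₂ (refl , refl)) = refl
    parity-outside r∉ (suc m) v a eq marked | inj₂ (w , vw , eq′) | no ≠ =
      move {a} (parity-outside r∉ m w (not a) (suc-injective (trans eq′ eq))
        (trans (sym (isCut a vw ≠)) marked)) (f-parent eq′)

    module _ {b : Bool} (r∈ : C (r , b) ≡ true) where

      -- Parents of vertices outside the side lead to `r` through `y`. In particular `x` is farther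
      -- away than `y`, so it is not the parent of `y`, and `parity-inside` can follow parents
      -- without leaving the side.
      farther : ∀ m w → d w ≡ m → (∀ a → C (w , a) ≡ false) → d y < d w
      farther m w eq w∉ with parent w
      ... | inj₁ refl = contradiction (trans (sym r∈) (w∉ b)) λ ()
      farther zero w eq w∉ | inj₂ (v , wv , eq′) = contradiction (trans eq′ eq) λ ()
      farther (suc m) w eq w∉ | inj₂ (v , wv , eq′) with sameEdge? w v x y
      ... | yes (inj₁ (refl , refl)) = subst (d y <_) eq′ (n<1+n (d y))
      ... | yes (inj₂ (refl , refl)) = contradiction (trans (sym at-y) (w∉ false)) λ ()
      ... | no ≠ = <-trans
        (farther m v (suc-injective (trans eq′ eq)) λ a → trans (isCut a (adj-sym G wv) (≠ ∘ same-flipˡ)) (w∉ (not a)))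
        (subst (d v <_) eq′ (n<1+n (d v)))

      parity-inside : ∀ m v a → d v ≡ m → C (v , a) ≡ true → a xor f v ≡ b xor f r
      parity-inside m v a eq marked with parent v
      ... | inj₁ refl with a ≟ᵇ b
      ...   | yes refl = refl
      ...   | no neq = contradiction
        (trans (sym marked) (trans (cong (λ c → C (r , c)) (¬-not neq)) (pendant-exclusive P r b r∈))) λ ()
      parity-inside zero v a eq marked | inj₂ (w , vw , eq′) = contradiction (trans eq′ eq) λ ()
      parity-inside (suc m) v a eq marked | inj₂ (w , vw , eq′) with sameEdge? v w x y
      ... | yes (inj₁ (refl , refl)) = contradiction (trans (sym marked) (at-x a)) λ ()
      ... | yes (inj₂ (refl , refl)) = contradiction
        (<-trans (farther _ w refl at-x) (subst (d w <_) eq′ (n<1+n (d w)))) (<-irrefl refl)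
      ... | no ≠ =
        move {a} (parity-inside m w (not a) (suc-injective (trans eq′ eq))
          (trans (sym (isCut a vw ≠)) marked)) (f-parent eq′)

    -- Consequently `Side (f y)` contains only states `(v , f v)` and `Side (not (f y))` only states
    -- `(v , not (f v))`, for all pendant sides at once. This makes their directions coherent.
    pendant-parity : ∀ v a → C (v , a) ≡ true → a xor f v ≡ f y
    pendant-parity v a marked with C (r , false) ≟ᵇ true | C (r , true) ≟ᵇ true
    ... | no ¬p | no ¬q = parity-outside (λ { false → ¬-not ¬p ; true → ¬-not ¬q }) _ v a refl marked
    ... | yes p | _     = trans (parity-inside p _ v a refl marked) (sym (parity-inside p _ y false refl at-y))
    ... | no _  | yes q = trans (parity-inside q _ v a refl marked) (sym (parity-inside q _ y false refl at-y))

    Side : Bool → State n → Bool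
    Side c (v , a) = C (v , a xor c)

    side-x : ∀ c a → Side c (x , a) ≡ false
    side-x c a = at-x (a xor c)

    side-y : ∀ c → Side c (y , c) ≡ true
    side-y c = trans (cong (λ a → C (y , a)) (xor-same c)) at-y

    side-σy : ∀ c → Side c (y , not c) ≡ false
    side-σy c = trans (cong (λ a → C (y , a)) (trans (sym (not-distribˡ-xor c c)) (cong not (xor-same c)))) at-σy

    side-cut : ∀ c {u v} a → Adj G u v → Side c (u , a) ≡ Side c (v , not a) ⊎
      ((u , a) ≡ (x , not c) × (v , not a) ≡ (y , c)) ⊎ ((u , a) ≡ (y , c) × (v , not a) ≡ (x , not c))
    side-cut c {u} {v} a uv with sameEdge? u v x y
    ... | no ≠ = inj₁ (trans (isCut (a xor c) uv ≠) (cong (λ b → C (v , b)) (not-distribˡ-xor a c)))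
    ... | yes (inj₁ (refl , refl)) with a ≟ᵇ c
    ...   | yes refl = inj₁ (trans (side-x c a) (sym (side-σy c)))
    ...   | no neq with ¬-not neq
    ...     | refl = inj₂ (inj₁ (refl , cong (y ,_) (not-involutive c)))
    side-cut c {u} {v} a uv | yes (inj₂ (refl , refl)) with a ≟ᵇ c
    ...   | yes refl = inj₂ (inj₂ (refl , refl))
    ...   | no neq with ¬-not neq
    ...     | refl = inj₁ (trans (side-σy c) (sym (side-x c (not (not c)))))

  no-stubborn⇒colourable : (∀ x y → ¬ Stubborn G x y) → ProperColouring G
  -- A pendant edge gets colour `f y`, so `Side (f y)` can only be left and `Side (not (f y))` only
  -- be entered. A start `(u , f u)` lies in no copy of the second kind, an end `(v , not (f v))` in
  -- none of the first.
  no-stubborn⇒colourable none = properly-connected G k k-sym λ u v → f u , not (f v) ,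
    reorient (compatible u v) (col-strong (u , f u) (v , not (f v)))
    where
    open Maximal (maximal G connected nonbipartite (cartesianProduct (allFin n) (allFin n)))
    Choice : Fin n → Fin n → Bool → Set
    Choice u v k = col u v ≡ just k ⊎ (Pendant G u v × k ≡ f v) ⊎ (Pendant G v u × k ≡ f u)
    choice-sym : ∀ {u v k} → Choice u v k → Choice v u k
    choice-sym {u} {v} (inj₁ eq)      = inj₁ (trans (col-sym v u) eq)
    choice-sym (inj₂ (inj₁ p)) = inj₂ (inj₂ p)
    choice-sym (inj₂ (inj₂ p)) = inj₂ (inj₁ p)
    choose : ∀ {u v} → Adj G u v → ∃ (Choice u v)
    choose {u} {v} uv with All.lookup settled (∈-cartesianProduct⁺ (∈-allFin u) (∈-allFin v)) uv
    ... | inj₁ (k , eq)          = k , inj₁ eq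
    ... | inj₂ (inj₁ stub)       = contradiction stub (none u v)
    ... | inj₂ (inj₂ (inj₁ P)) = f v , inj₂ (inj₁ (P , refl))
    ... | inj₂ (inj₂ (inj₂ P)) = f u , inj₂ (inj₂ (P , refl))
    chosen = symmetric-choice (adj? G) (adj-sym G) Choice choice-sym choose
    k = proj₁ chosen
    k-sym = proj₁ (proj₂ chosen)
    data Bad : State n → State n → (State n → Bool) → Set where
      into  : ∀ {x y} (P : Pendant G x y) → Bad (x , not (f y)) (y , f y) (Side P (f y))
      outof : ∀ {x y} (P : Pendant G x y) → Bad (y , not (f y)) (x , f y) (Side P (not (f y)))
    cut-arc : ∀ {x y} (P : Pendant G x y) c {s t} → Lift (Allow G col) s t →
      Side P c s ≡ Side P c t ⊎ (s ≡ (x , not c) × t ≡ (y , c)) ⊎ (s ≡ (y , c) × t ≡ (x , not c))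
    cut-arc P c {_ , a} ((uv , _) , refl) = side-cut P c a uv
    bad-cut : ∀ {u w h} → Bad u w h → h u ≢ h w × (∀ {s t} → Lift (Allow G col) s t →
      h s ≡ h t ⊎ (s ≡ u × t ≡ w) ⊎ (s ≡ w × t ≡ u))
    bad-cut (into {x} {y} P) =
      (λ eq → contradiction (trans (sym (side-x P (f y) (not (f y)))) (trans eq (side-y P (f y)))) λ ()) ,
      cut-arc P (f y)
    bad-cut (outof {x} {y} P) =
      (λ eq → contradiction (trans (sym (side-y P (not (f y)))) (trans eq (side-x P (not (f y)) (f y)))) λ ()) ,
      λ {s} {t} arc → subst
        (λ c → Side P (not (f y)) s ≡ Side P (not (f y)) t ⊎
          (s ≡ (y , not (f y)) × t ≡ (x , c)) ⊎ (s ≡ (x , c) × t ≡ (y , not (f y))))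
        (not-involutive (f y)) (Sum.map id swap (cut-arc P (not (f y)) arc))
    wrong : ∀ {u v a} → Choice u v (k u v) → Allowed G (col u v) a → k u v ≢ a →
      ∃ (Bad (u , a) (v , not a))
    wrong {a = a} (inj₁ eq) ok neq = contradiction (sym (subst (λ m → Allowed G m a) eq ok)) neq
    wrong {u} {v} (inj₂ (inj₁ (P , eq))) _ neq with ¬-not (neq ∘ sym)
    ... | refl rewrite eq | not-involutive (f v) = _ , into P
    wrong {u} {v} (inj₂ (inj₂ (P , eq))) _ neq with ¬-not (neq ∘ sym)
    ... | refl rewrite eq | not-involutive (f u) = _ , outof P
    classify : ∀ {s t} → Lift (Allow G col) s t → Alternating G k s t ⊎ ∃ (Bad s t)
    classify {u , a} {v , _} ((uv , ok) , refl) with k u v ≟ᵇ a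
    ... | yes eq = inj₁ ((uv , eq) , refl)
    ... | no neq = inj₂ (wrong (proj₂ (proj₂ chosen) uv) ok neq)
    open Reorient (≡-dec _≟ᶠ_ _≟ᵇ_) Bad bad-cut classify
    compatible : ∀ u v → Compatible (u , f u) (v , not (f v))
    compatible u v (into {x} {y} P) _ t≡ = solve (f v) (f y)
      (pendant-parity P v (not (f v) xor f y) (trans t≡ (side-y P (f y))))
      where
      solve : ∀ a b → (not a xor b) xor a ≢ b
      solve true  true  ()
      solve true  false ()
      solve false true  ()
      solve false false ()
    compatible u v (outof {x} {y} P) s≡ _ = solve (f u) (f y)
      (pendant-parity P u (f u xor not (f y)) (trans s≡ (side-y P (not (f y)))))
      where
      solve : ∀ a b → (a xor not b) xor a ≢ b
      solve true  true  ()
      solve true  false ()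
      solve false true  ()
      solve false false ()

-- Graphs with a stubborn edge

crossing-arc : {V : Set} {R : V → V → Set} (K : V → Bool) → ∀ {u v} → Star R u v →
  K u ≡ true → K v ≡ false → ∃[ z ] ∃[ z′ ] (R z z′ × K z ≡ true × K z′ ≡ false)
crossing-arc K ε u∈ v∉ = contradiction (trans (sym u∈) v∉) λ ()
crossing-arc K (_◅_ {_} {w} r p) u∈ v∉ with K w ≟ᵇ true
... | yes w∈ = crossing-arc K p w∈ v∉
... | no w∉  = _ , w , r , u∈ , ¬-not w∉

other-side : ∀ {a b c : Bool} → a ≢ b → a ≢ c → b ≡ c
other-side a≢b a≢c = not-injective (trans (sym (¬-not a≢b)) (¬-not a≢c))

module StubbornEdge {n : ℕ} (G : Graph n) (connected : Connected G) (nonbipartite : ¬ Bipartite G)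
  {x y : Fin n} (stubborn : Stubborn G x y) where

  open Maximal (maximal G connected nonbipartite (cartesianProduct (allFin n) (allFin n)))

  f : Fin n → Bool
  f = halves G connected x y

  f-proper : BipartiteWithout G x y f
  f-proper = stubborn⇒bipartite G connected stubborn

  f-ends : f x ≡ f y
  f-ends = bipartite-ends G nonbipartite {f = f} f-proper

  Free : Fin n → Fin n → Set
  Free u v = Adj G u v × ¬ SameEdge u v x y

  -- The arcs of the copy of G ∖ xy consisting of the states (v , f v); on the
  -- other copy they are reversed.
  R : Fin n → Fin n → Set
  R u v = Free u v × Allowed G (col u v) (f u)

  R? : Decidable R
  R? u v = (adj? G u v ×-dec ¬? (sameEdge? u v x y)) ×-dec allowed? G (col u v) (f u)

  data Arc : State n → State n → Set where
    forward  : ∀ {u v} → R u v → Arc (u , f u) (v , f v)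
    backward : ∀ {u v} → R v u → Arc (u , not (f u)) (v , not (f v))
    leave    : ∀ {u v} → SameEdge u v x y → Arc (u , f u) (v , not (f v))
    enter    : ∀ {u v} → SameEdge u v x y → Arc (u , not (f u)) (v , f v)

  same-f : ∀ {u v} → SameEdge u v x y → f u ≡ f v
  same-f (inj₁ (refl , refl)) = f-ends
  same-f (inj₂ (refl , refl)) = sym f-ends

  arc-view : ∀ {s t} → Lift (Allow G col) s t → Arc s t
  arc-view {u , a} {v , _} ((uv , ok) , refl) with sameEdge? u v x y | a ≟ᵇ f u
  ... | yes same | yes refl = subst (λ c → Arc (u , f u) (v , c)) (cong not (sym (same-f same))) (leave same)
  ... | yes same | no neq rewrite ¬-not neq =
    subst (λ c → Arc (u , not (f u)) (v , c)) (trans (sym (same-f same)) (sym (not-involutive _))) (enter same)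
  ... | no ≠ | yes refl = subst (λ c → Arc (u , f u) (v , c)) (f-proper uv ≠) (forward ((uv , ≠) , ok))
  ... | no ≠ | no neq rewrite ¬-not neq =
    subst (λ c → Arc (u , not (f u)) (v , c)) (cong not (f-proper uv ≠)) (backward ((adj-sym G uv , ≠ ∘ same-flipˡ) ,
      subst (λ m → Allowed G m (f v)) (col-sym u v) (subst (Allowed G (col u v)) (sym (f-proper uv ≠)) ok)))

  -- `A` and `B` are the traces of a set of states on the copies `(v , f v)` and `(v , not (f v))`.
  -- Nonempty and closed under arcs, it is everything because the coloured cover is strong.
  closed-everywhere : (A B : Fin n → Set) → (∀ {u v} → R u v → A u → A v) → (∀ {u v} → R v u → B u → B v) →
    (∀ {u v} → SameEdge u v x y → A u → B v) → (∀ {u v} → SameEdge u v x y → B u → A v) →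
    ∀ {u} → A u ⊎ B u → ∀ v → A v × B v
  closed-everywhere A B fwd bwd lv en {u} start v = in-A (reach start (f v)) , in-B (reach start (not (f v)))
    where
    Z : State n → Set
    Z (w , a) = (a ≡ f w × A w) ⊎ (a ≡ not (f w) × B w)
    in-A : ∀ {w} → Z (w , f w) → A w
    in-A (inj₁ (_ , p))  = p
    in-A (inj₂ (eq , _)) = contradiction eq (not-¬ refl)
    in-B : ∀ {w} → Z (w , not (f w)) → B w
    in-B (inj₁ (eq , _)) = contradiction (sym eq) (not-¬ refl)
    in-B (inj₂ (_ , p))  = p
    arc : ∀ {s t} → Arc s t → Z s → Z t
    arc (forward r)  z = inj₁ (refl , fwd r (in-A z))
    arc (backward r) z = inj₂ (refl , bwd r (in-B z))
    arc (leave s)    z = inj₂ (refl , lv s (in-A z))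
    arc (enter s)    z = inj₁ (refl , en s (in-B z))
    reach : A u ⊎ B u → ∀ b → Z (v , b)
    reach (inj₁ p) b = preserve Z (arc ∘ arc-view) (col-strong (u , f u) (v , b)) (inj₁ (refl , p))
    reach (inj₂ p) b = preserve Z (arc ∘ arc-view) (col-strong (u , not (f u)) (v , b)) (inj₂ (refl , p))

  -- A walk of the cover changes copies only at `x` or `y`. Closed sets built from `Star R` connect
  -- each vertex to and from one of these ends, and then the ends with each other.
  R-strong : Strong R
  R-strong u v = [ id , _◅◅ y⇝x ]′ (to-ends u) ◅◅ [ id , x⇝y ◅◅_ ]′ (from-ends v)
    where
    R⋆? = reachable? R?
    to-ends : ∀ u → Star R u x ⊎ Star R u y
    to-ends u with R⋆? u x | R⋆? u y
    ... | yes p | _     = inj₁ p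
    ... | no _  | yes p = inj₂ p
    ... | no ¬p | no ¬q = ⊥-elim (proj₂ (closed-everywhere (Star R u) (λ _ → ⊥) (λ r p → p ◅◅ return r) (λ _ ())
      (λ { (inj₁ (refl , _)) → ¬p ; (inj₂ (refl , _)) → ¬q }) (λ _ ()) (inj₁ ε) u))
    from-ends : ∀ v → Star R x v ⊎ Star R y v
    from-ends v with R⋆? x v | R⋆? y v
    ... | yes p | _     = inj₁ p
    ... | no _  | yes p = inj₂ p
    ... | no ¬p | no ¬q = ⊥-elim (proj₁ (closed-everywhere (λ _ → ⊥) (λ w → Star R w v) (λ _ ()) _◅_
      (λ _ ()) (λ { (inj₁ (refl , _)) → ¬p ; (inj₂ (refl , _)) → ¬q }) (inj₂ ε) v))
    x⇝y : Star R x y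
    x⇝y with R⋆? x y
    ... | yes p = p
    -- If `x` does not reach `y`, the first copy is left only at `x`, arriving at `y` in the second,
    -- which is left only at `y`, arriving at `x`. So the set is closed, and it contains `y`.
    ... | no ¬p = proj₁ (closed-everywhere (Star R x) (λ w → Star R w y) (λ r p → p ◅◅ return r) _◅_
      (λ { (inj₁ (refl , refl)) _ → ε ; (inj₂ (refl , refl)) p → contradiction p ¬p })
      (λ { (inj₁ (refl , refl)) p → contradiction p ¬p ; (inj₂ (refl , refl)) _ → ε }) (inj₁ ε) y)
    y⇝x : Star R y x
    y⇝x with R⋆? y x
    ... | yes p = p
    ... | no ¬p = proj₁ (closed-everywhere (Star R y) (λ w → Star R w x) (λ r p → p ◅◅ return r) _◅_
      (λ { (inj₁ (refl , refl)) p → contradiction p ¬p ; (inj₂ (refl , refl)) _ → ε })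
      (λ { (inj₁ (refl , refl)) _ → ε ; (inj₂ (refl , refl)) p → contradiction p ¬p }) (inj₁ ε) x)

  -- ab is a bridge of G ∖ xy, with sides given by h.
  record BridgeCut (a b : Fin n) (h : Fin n → Bool) : Set where
    field
      edge    : Free a b
      differs : h a ≢ h b
      only    : ∀ {u v} → Free u v → ¬ SameEdge u v a b → h u ≡ h v
      kind    : Stubborn G a b ⊎ h x ≡ h y

  open BridgeCut

  bridge-flip : ∀ {a b h} → BridgeCut a b h → BridgeCut b a h
  bridge-flip cut = record
    { edge    = adj-sym G (proj₁ (edge cut)) , proj₂ (edge cut) ∘ same-flipˡ
    ; differs = differs cut ∘ sym
    ; only    = λ uv ≠ → only cut uv (≠ ∘ same-flipʳ)
    ; kind    = Sum.map (stubborn-sym G) id (kind cut) }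

  -- Forgetting the copy turns `C` into a side of `G`. The edge `xy` is not `ab`, so it does not
  -- cross the cut.
  pendant⇒cut : ∀ {a b} → Free a b → Pendant G a b → ∃ (BridgeCut a b)
  pendant⇒cut {a} {b} ab P = h , record
    { edge    = ab
    ; differs = λ eq → contradiction (trans (sym at-a) (trans eq at-b)) λ ()
    ; only    = λ uv → only′ (proj₁ uv)
    ; kind    = inj₂ (only′ (proj₁ stubborn) (proj₂ ab ∘ same-sym)) }
    where
    open Pendant P
    h : Fin n → Bool
    h v = C (v , false) ∨ C (v , true)
    at-a : h a ≡ false
    at-a = cong₂ _∨_ (at-x false) (at-x true)
    at-b : h b ≡ true
    at-b = cong₂ _∨_ at-y at-σy
    only′ : ∀ {u v} → Adj G u v → ¬ SameEdge u v a b → h u ≡ h v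
    only′ {u} {v} uv ≠ = trans (cong₂ _∨_ (isCut false uv ≠) (isCut true uv ≠)) (∨-comm (C (v , true)) (C (v , false)))

  -- Two 2-colourings, of G ∖ xy and of G ∖ ab, agree on one side of ab only.
  stubborn⇒cut : ∀ {a b} → Free a b → Stubborn G a b → ∃ (BridgeCut a b)
  stubborn⇒cut {a} {b} ab@(adj , ≠xy) stub = h , record
    { edge    = ab
    ; differs = flip-one (f-proper adj ≠xy) (bipartite-ends G nonbipartite {f = g} g-proper)
    ; only    = λ (uv , ≠) ≠ab → flip-both (f-proper uv ≠) (g-proper uv ≠ab)
    ; kind    = inj₁ stub }
    where
    g : Fin n → Bool
    g = halves G connected a b
    g-proper : BipartiteWithout G a b g
    g-proper = stubborn⇒bipartite G connected stub
    h : Fin n → Bool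
    h v = f v xor g v

  unavoidable⇒cut : ∀ {a b} → Free a b → Unavoidable G a b → ∃ (BridgeCut a b)
  unavoidable⇒cut ab (inj₁ stub)     = stubborn⇒cut ab stub
  unavoidable⇒cut ab (inj₂ (inj₁ P)) = pendant⇒cut ab P
  unavoidable⇒cut (ab , ≠) (inj₂ (inj₂ P)) with pendant⇒cut (adj-sym G ab , ≠ ∘ same-flipˡ) P
  ... | h , cut = h , bridge-flip cut

  -- Directing the bridges of G without `xy` towards target vertices

  module Directed (target : Fin n → Fin n → Fin n) (target-sym : ∀ a b → target a b ≡ target b a) where

    -- Colour `f a` lets the copy `(v , f v)` pass from `a` to `b`; bridges are directed towards
    -- their targets this way. Colour `f x` makes `xy` lead from that copy into the other one at
    -- both ends.
    Choice : Fin n → Fin n → Bool → Set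
    Choice a b k = (¬ SameEdge a b x y × col a b ≡ just k) ⊎ (SameEdge a b x y × k ≡ f x) ⊎
      ∃[ h ] (BridgeCut a b h × ((k ≡ f a × h b ≡ h (target a b)) ⊎ (k ≡ f b × h a ≡ h (target a b))))

    choice-sym : ∀ {a b k} → Choice a b k → Choice b a k
    choice-sym {a} {b} (inj₁ (≠ , eq)) = inj₁ (≠ ∘ same-flipˡ , trans (col-sym b a) eq)
    choice-sym (inj₂ (inj₁ (s , eq))) = inj₂ (inj₁ (same-flipˡ s , eq))
    choice-sym {a} {b} (inj₂ (inj₂ (h , cut , dir))) rewrite target-sym a b = inj₂ (inj₂ (h , bridge-flip cut , swap dir))

    choose : ∀ {a b} → Adj G a b → ∃ (Choice a b)
    choose {a} {b} ab with sameEdge? a b x y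
    ... | yes s = f x , inj₂ (inj₁ (s , refl))
    ... | no ≠ with All.lookup settled (∈-cartesianProduct⁺ (∈-allFin a) (∈-allFin b)) ab
    ...   | inj₁ (k , eq) = k , inj₁ (≠ , eq)
    ...   | inj₂ un with unavoidable⇒cut (ab , ≠) un
    ...     | h , cut with h b ≟ᵇ h (target a b)
    ...       | yes eq = f a , inj₂ (inj₂ (h , cut , inj₁ (refl , eq)))
    ...       | no neq = f b , inj₂ (inj₂ (h , cut , inj₂ (refl , other-side (differs cut ∘ sym) neq)))

    chosen = symmetric-choice (adj? G) (adj-sym G) Choice choice-sym choose

    k : Fin n → Fin n → Bool
    k = proj₁ chosen

    Good : Fin n → Fin n → Set
    Good u v = Free u v × k u v ≡ f u

    Good? : Decidable Good
    Good? u v = (adj? G u v ×-dec ¬? (sameEdge? u v x y)) ×-dec (k u v ≟ᵇ f u)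

    Bad : Fin n → Fin n → (Fin n → Bool) → Set
    Bad u w h = BridgeCut u w h × h w ≢ h (target u w)

    bad-cut : ∀ {u w h} → Bad u w h → h u ≢ h w × (∀ {a b} → R a b →
      h a ≡ h b ⊎ (a ≡ u × b ≡ w) ⊎ (a ≡ w × b ≡ u))
    bad-cut {u} {w} {h} (cut , _) = differs cut , check
      where
      check : ∀ {a b} → R a b → h a ≡ h b ⊎ SameEdge a b u w
      check {a} {b} (free , _) with sameEdge? a b u w
      ... | yes same = inj₂ same
      ... | no ≠ = inj₁ (only cut free ≠)

    classify : ∀ {u w} → R u w → Good u w ⊎ ∃ (Bad u w)
    classify {u} {w} (uw@(adj , ≠) , ok) with proj₂ (proj₂ chosen) adj
    ... | inj₁ (_ , eq) = inj₁ (uw , sym (subst (λ m → Allowed G m (f u)) eq ok))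
    ... | inj₂ (inj₁ (same , _)) = contradiction same ≠
    ... | inj₂ (inj₂ (h , cut , inj₁ (eq , _))) = inj₁ (uw , eq)
    ... | inj₂ (inj₂ (h , cut , inj₂ (_ , eq))) = inj₂ (h , cut , λ eq′ → differs cut (trans eq (sym eq′)))

    open Reorient _≟ᶠ_ Bad bad-cut classify using (reorient)

    Consistent : Fin n → Fin n → Set
    Consistent s t = ∀ {a b h} → BridgeCut a b h → h s ≡ h t ⊎ h t ≡ h (target a b)

    reach : ∀ {s t} → Consistent s t → Star Good s t
    reach {s} {t} consistent = reorient
      (λ { (cut , wrong) s≡ t≡ → [ (λ eq → differs cut (trans (sym s≡) (trans eq t≡)))
                                 , (λ eq → wrong (trans (sym t≡) eq)) ] (consistent cut) })
      (R-strong s t)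

    -- A walk in one copy, the reversal of a walk in the other, or a change of copies along `xy`
    -- after which the second walk is used backwards.
    Linked : Fin n → Fin n → Set
    Linked u v = Star Good u v ⊎ Star Good v u ⊎ (Star Good u x × Star Good v y) ⊎ (Star Good u y × Star Good v x)

    linked⇒colourable : (∀ u v → Linked u v) → ProperColouring G
    linked⇒colourable linked = properly-connected G k (proj₁ (proj₂ chosen)) λ u v → link (linked u v)
      where
      fwd : ∀ {u v} → Star Good u v → Star (Alternating G k) (u , f u) (v , f v)
      fwd = gmap (λ v → v , f v) λ { ((uv , ≠) , eq) → (uv , eq) , f-proper uv ≠ }
      bwd : ∀ {u v} → Star Good u v → Star (Alternating G k) (v , not (f v)) (u , not (f u))
      bwd p = σ-reverse⋆ (λ {u} {v} (uv , eq) → adj-sym G uv , trans (proj₁ (proj₂ chosen) v u) eq) (fwd p)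
      kxy : k x y ≡ f x
      kxy with proj₂ (proj₂ chosen) (proj₁ stubborn)
      ... | inj₁ (≠ , _) = contradiction (inj₁ (refl , refl)) ≠
      ... | inj₂ (inj₁ (_ , eq)) = eq
      ... | inj₂ (inj₂ (_ , cut , _)) = contradiction (inj₁ (refl , refl)) (proj₂ (edge cut))
      link : ∀ {u v} → Linked u v → ∃[ a ] ∃[ b ] Star (Alternating G k) (u , a) (v , b)
      link (inj₁ p) = _ , _ , fwd p
      link (inj₂ (inj₁ p)) = _ , _ , bwd p
      link (inj₂ (inj₂ (inj₁ (p , q)))) = _ , _ ,
        fwd p ◅◅ ((proj₁ stubborn , kxy) , cong not (sym f-ends)) ◅ bwd q
      link (inj₂ (inj₂ (inj₂ (p , q)))) = _ , _ ,
        fwd p ◅◅ ((adj-sym G (proj₁ stubborn) , trans (proj₁ (proj₂ chosen) y x) (trans kxy f-ends)) , cong not f-ends) ◅ bwd q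

-- 𝒮-free components and bridges

component-walk : ∀ {n} (G : Graph n) {K} → SFreeComponent G K → ∀ {u v} → u ∈ₛ K → v ∈ₛ K →
  Star (λ a b → AdjNoStubborn G a b × a ∈ₛ K × b ∈ₛ K) u v
component-walk G {K} (_ , joined , closed) u∈ v∈ with joined _ _ u∈ v∈
... | _ , walk , _ = go u∈ (walk⇒star walk)
  where
  go : ∀ {u v} → u ∈ₛ K → Star (AdjNoStubborn G) u v → Star (λ a b → AdjNoStubborn G a b × a ∈ₛ K × b ∈ₛ K) u v
  go u∈ ε = ε
  go {u} u∈ (_◅_ {_} {w} r p) = (r , u∈ , w∈) ◅ go w∈ p
    where
    w∈ : w ∈ₛ K
    w∈ = closed u w u∈ (star⇒joined u (return (r , w)))

leaving⇒stubborn : ∀ {n} (G : Graph n) → Connected G → ∀ {K} → SFreeComponent G K →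
  ∀ {u v} → u ∈ₛ K → OutK K v → Adj G u v → Stubborn G u v
leaving⇒stubborn G connected (_ , _ , closed) {u} {v} u∈ v∉ uv with stubborn? G connected u v
... | yes stub = stub
... | no ¬stub = contradiction
  (trans (sym (closed u v u∈ (star⇒joined u (return ((uv , ¬stub) , v))))) v∉) λ ()

module _ {n : ℕ} (G : Graph n) (connected : Connected G) (nonbipartite : ¬ Bipartite G)
  {x y : Fin n} (stubborn : Stubborn G x y) {K : VSet} (component : SFreeComponent G K) where

  open StubbornEdge G connected nonbipartite stubborn
  open BridgeCut

  constant-on-K : ∀ {a b h} → BridgeCut a b h → (a ∈ₛ K → b ∈ₛ K → Stubborn G a b) →
    ∀ {u v} → u ∈ₛ K → v ∈ₛ K → h u ≡ h v
  constant-on-K {a} {b} {h} cut stub-in u∈ v∈ = constant h step-const (component-walk G component u∈ v∈)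
    where
    step-const : ∀ {p q} → AdjNoStubborn G p q × p ∈ₛ K × q ∈ₛ K → h p ≡ h q
    step-const ((pq , ¬stub) , p∈ , q∈) = only cut
      (pq , λ { (inj₁ (refl , refl)) → ¬stub stubborn ; (inj₂ (refl , refl)) → ¬stub (stubborn-sym G stubborn) })
      λ { (inj₁ (refl , refl)) → ¬stub (stub-in p∈ q∈) ; (inj₂ (refl , refl)) → ¬stub (stubborn-sym G (stub-in q∈ p∈)) }

  -- A stubborn `ab` would leave `h` constant on `K`, which is connected by non-stubborn edges,
  -- against `differs`.
  cut-inside : ∀ {a b h} → BridgeCut a b h → a ∈ₛ K → b ∈ₛ K → h x ≡ h y
  cut-inside cut a∈ b∈ with kind cut
  ... | inj₂ eq   = eq
  ... | inj₁ stub = contradiction (constant-on-K cut (λ _ _ → stub) a∈ b∈) (differs cut)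

  -- All bridges point to `x` and none separates `x` from `y`. So everything leads to `x` and on to
  -- `y`, and any two vertices are linked across `xy`.
  everything⇒colourable : EmptyOutside K → ProperColouring G
  everything⇒colourable all∈ = linked⇒colourable λ u v → inj₂ (inj₂ (inj₁
    (reach (λ _ → inj₂ refl) , reach (λ _ → inj₂ refl) ◅◅ reach λ cut → inj₁ (cut-inside cut (all∈ _) (all∈ _)))))
    where open Directed (λ _ _ → x) (λ _ _ → refl)

  -- The form in which the hypothesis on the complement of `K` is used: a path from `p` to `q`
  -- carries all its bridges. For `p` equal to `q` there are none.
  Separated : Fin n → Fin n → Set
  Separated p q = ∀ {a b h} → OutK K a → OutK K b → BridgeCut a b h → h p ≢ h q

  module _ (x∈ : x ∈ₛ K) (y∉ : OutK K y) (outside : ConnectedOn (OutK K) (Adj G)) where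

    free-outside : ∀ {u v} → OutK K u → OutK K v → Adj G u v → Free u v
    free-outside u∉ v∉ uv = uv , λ
      { (inj₁ (refl , _)) → contradiction (trans (sym x∈) u∉) λ ()
      ; (inj₂ (_ , refl)) → contradiction (trans (sym x∈) v∉) λ () }

    constant-outside : {A : Set} (j : Fin n → A) → (∀ {u v} → OutK K u → OutK K v → Adj G u v → j u ≡ j v) →
      ∀ {u v} → OutK K u → OutK K v → j u ≡ j v
    constant-outside j eq u∉ v∉ = constant j (λ (uv , u∉ , v∉) → eq u∉ v∉ uv) (joined⇒star (outside _ _ u∉ v∉))

    cut-constant-outside : ∀ {a b h} → BridgeCut a b h → ¬ (OutK K a × OutK K b) →
      ∀ {u v} → OutK K u → OutK K v → h u ≡ h v
    cut-constant-outside {h = h} cut ¬out = constant-outside h λ u∉ v∉ uv → only cut (free-outside u∉ v∉ uv)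
      λ { (inj₁ (refl , refl)) → ¬out (u∉ , v∉) ; (inj₂ (refl , refl)) → ¬out (v∉ , u∉) }

    same-edge-same-cut : ∀ {a b h h′} → BridgeCut a b h → BridgeCut a b h′ →
      ∀ {u v} → OutK K u → OutK K v → h u xor h′ u ≡ h v xor h′ v
    same-edge-same-cut {a} {b} {h} {h′} cut cut′ = constant-outside (λ w → h w xor h′ w) step-const
      where
      opposite : ∀ {i k l m} → i ≢ k → l ≢ m → i xor l ≡ k xor m
      opposite {k = k} {m = m} i≢k l≢m rewrite ¬-not i≢k | ¬-not l≢m = both k m
        where
        both : ∀ k m → not k xor not m ≡ k xor m
        both true  m = refl
        both false m = not-involutive m
      step-const : ∀ {i k} → OutK K i → OutK K k → Adj G i k → h i xor h′ i ≡ h k xor h′ k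
      step-const {i} {k} i∉ k∉ ik with sameEdge? i k a b
      ... | yes (inj₁ (refl , refl)) = opposite (differs cut) (differs cut′)
      ... | yes (inj₂ (refl , refl)) = opposite (differs cut ∘ sym) (differs cut′ ∘ sym)
      ... | no ≠ = cong₂ _xor_ (only cut (free-outside i∉ k∉ ik) ≠) (only cut′ (free-outside i∉ k∉ ik) ≠)

    -- Beyond a′b′, as seen from ab, the cut of ab is invisible: collapse the
    -- near side of a′b′ to the value of h at a′.
    beyond-constant : ∀ {a b h a′ b′ h′} → BridgeCut a b h → BridgeCut a′ b′ h′ → ¬ SameEdge a b a′ b′ →
      ∀ {u v} → OutK K u → OutK K v → h′ u ≢ h′ a → h′ v ≢ h′ a → h u ≡ h v
    beyond-constant {a} {b} {h} {a′} {b′} {h′} cut cut′ ≠ u∉ v∉ u≢ v≢ =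
      trans (sym (far u≢)) (trans (constant-outside j j-const u∉ v∉) (far v≢))
      where
      j : Fin n → Bool
      j w = if does (h′ w ≟ᵇ h′ a) then h a′ else h w
      far : ∀ {w} → h′ w ≢ h′ a → j w ≡ h w
      far {w} neq = cong (λ d → if d then h a′ else h w) (dec-false (h′ w ≟ᵇ h′ a) neq)
      near : ∀ {w} → h′ w ≡ h′ a → j w ≡ h a′
      near {w} eq = cong (λ d → if d then h a′ else h w) (dec-true (h′ w ≟ᵇ h′ a) eq)
      at-end : ∀ {w} → h w ≡ h a′ → j w ≡ h a′
      at-end {w} eq with h′ w ≟ᵇ h′ a
      ... | yes _ = refl
      ... | no _  = eq
      ends : h a′ ≡ h b′
      ends = only cut (edge cut′) (≠ ∘ same-sym)
      ends′ : h′ a ≡ h′ b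
      ends′ = only cut′ (edge cut) ≠
      j-const : ∀ {i k} → OutK K i → OutK K k → Adj G i k → j i ≡ j k
      j-const {i} {k} i∉ k∉ ik with sameEdge? i k a b | sameEdge? i k a′ b′
      ... | yes (inj₁ (refl , refl)) | _ = trans (near refl) (sym (near (sym ends′)))
      ... | yes (inj₂ (refl , refl)) | _ = trans (near (sym ends′)) (sym (near refl))
      ... | no _ | yes (inj₁ (refl , refl)) = trans (at-end refl) (sym (at-end (sym ends)))
      ... | no _ | yes (inj₂ (refl , refl)) = trans (at-end (sym ends)) (sym (at-end refl))
      ... | no ≠₁ | no ≠₂ = cong₂ (λ d e → if does (d ≟ᵇ h′ a) then h a′ else e)
        (only cut′ (free-outside i∉ k∉ ik) ≠₂) (only cut (free-outside i∉ k∉ ik) ≠₁)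

    -- Bridges separating `p` from `q` are linearly ordered along a path between them. `u` lies
    -- behind the cut `h` and before `h′`, which fixes their order; `v` forces the opposite one.
    no-crossing : ∀ {a b h a′ b′ h′ u v p q} → BridgeCut a b h → BridgeCut a′ b′ h′ →
      OutK K u → OutK K v → OutK K p → OutK K q → h p ≢ h q → h′ p ≢ h′ q →
      h u ≡ h q → h v ≡ h p → h′ u ≡ h′ p → h′ v ≡ h′ q → ⊥
    no-crossing {a} {b} {h} {a′} {b′} {h′} {u} {v} {p} {q} cut cut′ u∉ v∉ p∉ q∉ p≢q p≢′q u≡q v≡p u≡′p v≡′q =
      decide (sameEdge? a b a′ b′)
      where
      xor-cancel : ∀ {a b} c → a xor c ≡ b xor c → a ≡ b
      xor-cancel {true}  {true}  _     _ = refl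
      xor-cancel {false} {false} _     _ = refl
      xor-cancel {true}  {false} true  ()
      xor-cancel {true}  {false} false ()
      xor-cancel {false} {true}  true  ()
      xor-cancel {false} {true}  false ()
      same : BridgeCut a b h′ → ⊥
      same cut″ = p≢q (xor-cancel (h′ p)
        (trans (same-edge-same-cut cut cut″ p∉ u∉) (cong₂ _xor_ u≡q u≡′p)))
      decide : Dec (SameEdge a b a′ b′) → ⊥
      decide (yes (inj₁ (refl , refl))) = same cut′
      decide (yes (inj₂ (refl , refl))) = same (bridge-flip cut′)
      decide (no ≠) with h′ a ≟ᵇ h′ p
      ... | yes a≡p = p≢q (trans (sym v≡p) (beyond-constant cut cut′ ≠ v∉ q∉ (λ eq → q≢ (trans (sym v≡′q) eq)) q≢))
        where
        q≢ : h′ q ≢ h′ a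
        q≢ eq = p≢′q (trans (sym a≡p) (sym eq))
      ... | no a≢p = p≢q (trans (beyond-constant cut cut′ ≠ p∉ u∉ (a≢p ∘ sym) (λ eq → a≢p (trans (sym eq) u≡′p))) u≡q)

    inside-or-outside : ∀ v → v ∈ₛ K ⊎ OutK K v
    inside-or-outside v with K v
    ... | true  = inj₁ refl
    ... | false = inj₂ refl

    -- For a bridge leaving `K`, `y` stands for the whole complement of `K`, on which the cut is
    -- constant.
    target : Fin n → Fin n → Fin n → Fin n
    target q a b = if K a then (if K b then x else y) else (if K b then y else q)

    target-sym : ∀ q a b → target q a b ≡ target q b a
    target-sym q a b with K a | K b
    ... | true  | true  = refl
    ... | true  | false = refl
    ... | false | true  = refl
    ... | false | false = refl

    module Towards (q : Fin n) = Directed (target q) (target-sym q)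

    data Position (q : Fin n) {a b h} (cut : BridgeCut a b h) : Set where
      within   : (∀ {u v} → OutK K u → OutK K v → h u ≡ h v) → h x ≡ h y → target q a b ≡ x → Position q cut
      across   : (∀ {u v} → u ∈ₛ K → v ∈ₛ K → h u ≡ h v) → (∀ {u v} → OutK K u → OutK K v → h u ≡ h v) →
        target q a b ≡ y → Position q cut
      beyond   : (∀ {u v} → u ∈ₛ K → v ∈ₛ K → h u ≡ h v) → OutK K a → OutK K b →
        target q a b ≡ q → Position q cut

    position : ∀ q {a b h} (cut : BridgeCut a b h) → Position q cut
    position q {a} {b} cut with inside-or-outside a | inside-or-outside b
    ... | inj₁ a∈ | inj₁ b∈ = within
      (cut-constant-outside cut λ (a∉ , _) → contradiction (trans (sym a∈) a∉) λ ()) (cut-inside cut a∈ b∈)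
      (cong₂ (λ i j → if i then (if j then x else y) else (if j then y else q)) a∈ b∈)
    ... | inj₁ a∈ | inj₂ b∉ = across
      (constant-on-K cut λ _ b∈ → contradiction (trans (sym b∈) b∉) λ ())
      (cut-constant-outside cut λ (a∉ , _) → contradiction (trans (sym a∈) a∉) λ ())
      (cong₂ (λ i j → if i then (if j then x else y) else (if j then y else q)) a∈ b∉)
    ... | inj₂ a∉ | inj₁ b∈ = across
      (constant-on-K cut λ a∈ _ → contradiction (trans (sym a∈) a∉) λ ())
      (cut-constant-outside cut λ (_ , b∉) → contradiction (trans (sym b∈) b∉) λ ())
      (cong₂ (λ i j → if i then (if j then x else y) else (if j then y else q)) a∉ b∈)
    ... | inj₂ a∉ | inj₂ b∉ = beyond
      (constant-on-K cut λ a∈ _ → contradiction (trans (sym a∈) a∉) λ ()) a∉ b∉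
      (cong₂ (λ i j → if i then (if j then x else y) else (if j then y else q)) a∉ b∉)

    module _ {p q : Fin n} (p∉ : OutK K p) (q∉ : OutK K q) (separated : Separated p q) where

      open Towards q

      K⇝x : ∀ {u} → u ∈ₛ K → Star Good u x
      K⇝x u∈ = reach λ {_} {_} {h} cut → case position q cut of λ
        { (within _ _ eq)   → inj₂ (cong h (sym eq))
        ; (across const _ _) → inj₁ (const u∈ x∈)
        ; (beyond const _ _ _) → inj₁ (const u∈ x∈) }

      -- A bridge inside `K` does not separate `x` from `y`, hence not from `z′`; one leaving `K`
      -- points outwards; one outside `K` cuts neither `K` nor the edge `zz′`.
      x⇝exit : ∀ {z z′} → Free z z′ → z ∈ₛ K → OutK K z′ → Star Good x z′
      x⇝exit {z} {z′} zz′ z∈ z′∉ = reach λ {a} {b} {h} cut → case position q cut of λ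
        { (within const eq _)  → inj₁ (trans eq (const y∉ z′∉))
        ; (across _ const eq)  → inj₂ (trans (const z′∉ y∉) (cong h (sym eq)))
        ; (beyond const a∉ b∉ _) → inj₁ (trans (const x∈ z∈) (only cut zz′ λ
            { (inj₁ (refl , _)) → contradiction (trans (sym z∈) a∉) λ ()
            ; (inj₂ (refl , _)) → contradiction (trans (sym z∈) b∉) λ () })) }

      Blocks : Fin n → Fin n → (Fin n → Bool) → Set
      Blocks u v h = h u ≡ h q × h v ≡ h p

      -- Only bridges outside `K` can obstruct. They point to `q`, so an obstacle has `u` on the
      -- side of `q` and `v` on the side of `p`.
      unblocked⇒reach : ∀ {u v} → OutK K u → OutK K v →
        (∀ {a b h} → OutK K a → OutK K b → BridgeCut a b h → ¬ Blocks u v h) → Star Good u v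
      unblocked⇒reach {u} {v} u∉ v∉ unblocked = reach consistent
        where
        consistent : Consistent u v
        consistent {a} {b} {h} cut with position q cut
        ... | within const _ _ = inj₁ (const u∉ v∉)
        ... | across _ const _ = inj₁ (const u∉ v∉)
        ... | beyond _ a∉ b∉ eq with h u ≟ᵇ h v | h v ≟ᵇ h q
        ...   | yes same | _ = inj₁ same
        ...   | no _ | yes v≡q = inj₂ (trans v≡q (cong h (sym eq)))
        ...   | no u≢v | no v≢q = contradiction
          (other-side (u≢v ∘ sym) v≢q , other-side {h q} (v≢q ∘ sym) (separated a∉ b∉ cut ∘ sym))
          (unblocked a∉ b∉ cut)

      -- Otherwise one bridge blocks the way from `u` to `v` and one the way back, which
      -- `no-crossing` forbids.
      comparable : ∀ {u v} → OutK K u → OutK K v → Star Good u v ⊎ Star Good v u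
      comparable {u} {v} u∉ v∉ with reachable? Good? u v | reachable? Good? v u
      ... | yes r | _     = inj₁ r
      ... | no _  | yes r = inj₂ r
      ... | no ¬r | no ¬s = contradiction
        (unblocked⇒reach u∉ v∉ λ a∉ b∉ cut (u≡ , v≡) → ¬s (unblocked⇒reach v∉ u∉ λ a′∉ b′∉ cut′ (v≡′ , u≡′) →
          no-crossing cut cut′ u∉ v∉ p∉ q∉ (separated a∉ b∉ cut) (separated a′∉ b′∉ cut′) u≡ v≡ u≡′ v≡′)) ¬r

      -- Everything in `K` leads to `x` and from there to `z′`. A vertex outside `K` is either
      -- reached from `z′` or reaches `z′` and then `y`, where it is linked with `K` across `xy`.
      exit⇒colourable : ∀ {z z′} → Free z z′ → z ∈ₛ K → OutK K z′ → Star Good z′ y → ProperColouring G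
      exit⇒colourable {z} {z′} zz′ z∈ z′∉ z′⇝y = linked⇒colourable linked
        where
        mixed : ∀ {u v} → u ∈ₛ K → OutK K v → Star Good u v ⊎ (Star Good u x × Star Good v y)
        mixed u∈ v∉ with comparable z′∉ v∉
        ... | inj₁ r = inj₁ (K⇝x u∈ ◅◅ x⇝exit zz′ z∈ z′∉ ◅◅ r)
        ... | inj₂ r = inj₂ (K⇝x u∈ , r ◅◅ z′⇝y)
        linked : ∀ u v → Linked u v
        linked u v with inside-or-outside u | inside-or-outside v
        ... | inj₁ u∈ | inj₁ v∈ = inj₂ (inj₂ (inj₁ (K⇝x u∈ , K⇝x v∈ ◅◅ x⇝exit zz′ z∈ z′∉ ◅◅ z′⇝y)))
        ... | inj₂ u∉ | inj₂ v∉ = [ inj₁ , inj₂ ∘ inj₁ ] (comparable u∉ v∉)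
        ... | inj₁ u∈ | inj₂ v∉ = [ inj₁ , inj₂ ∘ inj₂ ∘ inj₁ ] (mixed u∈ v∉)
        ... | inj₂ u∉ | inj₁ v∈ = [ inj₂ ∘ inj₁ , (λ (r , s) → inj₂ (inj₂ (inj₂ (s , r)))) ] (mixed v∈ u∉)

    -- `R-strong` yields an edge `zz′` other than `xy` leaving `K`. If directing towards `q` does
    -- not bring `z′` to `y`, exchanging `p` and `q` does, since two failures would contradict
    -- `no-crossing`.
    separated⇒colourable : ∀ {p q} → OutK K p → OutK K q → Separated p q → ProperColouring G
    separated⇒colourable {p} {q} p∉ q∉ separated with crossing-arc K (R-strong x y) x∈ y∉
    ... | z , z′ , (zz′ , _) , z∈ , z′∉
      with reachable? (Towards.Good? q) z′ y | reachable? (Towards.Good? p) z′ y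
    ... | yes r | _ = exit⇒colourable p∉ q∉ separated zz′ z∈ z′∉ r
    ... | no _ | yes r = exit⇒colourable q∉ p∉ (λ a∉ b∉ cut → separated a∉ b∉ cut ∘ sym) zz′ z∈ z′∉ r
    ... | no ¬r | no ¬s = contradiction
      (unblocked⇒reach p∉ q∉ separated z′∉ y∉ λ a∉ b∉ cut (z≡ , y≡) →
        ¬s (unblocked⇒reach q∉ p∉ (λ a∉ b∉ cut → separated a∉ b∉ cut ∘ sym) z′∉ y∉ λ a′∉ b′∉ cut′ (z≡′ , y≡′) →
          no-crossing cut cut′ z′∉ y∉ p∉ q∉ (separated a∉ b∉ cut) (separated a′∉ b′∉ cut′) z≡ y≡ z≡′ y≡′)) ¬r

    almost⇒colourable : AlmostTwoEdgeConnected G K → ProperColouring G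
    almost⇒colourable (inj₁ (_ , bridgeless)) = separated⇒colourable y∉ y∉ λ {a} {b} {h} a∉ b∉ cut _ →
      differs cut (constant h (λ ((uv , ≠) , u∉ , v∉) → only cut (free-outside u∉ v∉ uv) ≠)
        (joined⇒star (bridgeless a b a∉ b∉ (proj₁ (edge cut)) a b a∉ b∉)))
    almost⇒colourable (inj₂ (p , q , p∉ , q∉ , _ , _ , bridgeless)) = separated⇒colourable p∉ q∉
      λ {a} {b} {h} a∉ b∉ cut p≡q → differs cut (constant h
        (λ { (inj₁ (uv , ≠) , u∉ , v∉) → only cut (free-outside u∉ v∉ uv) ≠
           ; (inj₂ (inj₁ (refl , refl)) , _) → p≡q
           ; (inj₂ (inj₂ (refl , refl)) , _) → sym p≡q })
        (joined⇒star (bridgeless a b a∉ b∉ (proj₁ (edge cut)) a b a∉ b∉)))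

-- Sufficiency assembled

module _ {n : ℕ} (G : Graph n) (connected : Connected G) (nonbipartite : ¬ Bipartite G) where

  sufficient : ∃[ K ] (SFreeComponent G K × (EmptyOutside K ⊎ AlmostTwoEdgeConnected G K)) → ProperColouring G
  sufficient (K , component@((v₀ , v₀∈) , _) , condition)
    with any? (λ x → any? λ y → stubborn? G connected x y) | any? (λ v → K v ≟ᵇ false)
  ... | no none | _ = no-stubborn⇒colourable G connected nonbipartite λ x y stub → none (x , y , stub)
  ... | yes (x , y , stub) | no all∈ =
    everything⇒colourable G connected nonbipartite stub component λ v → ¬-not λ v∉ → all∈ (v , v∉)
  -- The stubborn edge found is exchanged for an edge leaving `K`, which is stubborn because `K` is
  -- an 𝒮-free component.
  ... | yes _ | yes (v , v∉) with crossing-arc K (star-adj G connected v₀ v) v₀∈ v∉ | condition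
  ...   | _ | inj₁ all∈ = contradiction (trans (sym (all∈ v)) v∉) λ ()
  ...   | x , y , xy , x∈ , y∉ | inj₂ almost =
    almost⇒colourable G connected nonbipartite (leaving⇒stubborn G connected component x∈ y∉ xy) component
      x∈ y∉ (outside almost) almost
    where
    outside : AlmostTwoEdgeConnected G K → ConnectedOn (OutK K) (Adj G)
    outside (inj₁ (conn , _)) = conn
    outside (inj₂ (_ , _ , _ , _ , _ , conn , _)) = conn

-- Necessity

module _ {V : Set} {T : V → V → Set} (T-refl : ∀ {v} → T v v)
  (T-trans : ∀ {u v w} → T u v → T v w → T u w) where

  -- The candidate `r`, initially `m`, is replaced whenever a strictly smaller element of the
  -- preorder appears.
  minimal-in : Decidable T → (m : V) → ∀ vs → ∃[ r ] All (λ u → T u r → T r u) vs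
  minimal-in T? m [] = m , []
  minimal-in T? m (v ∷ vs) with minimal-in T? m vs
  ... | r , min with T? v r | T? r v
  ...   | no ¬vr | _      = r , (λ vr → contradiction vr ¬vr) ∷ min
  ...   | yes _  | yes rv = r , (λ _ → rv) ∷ min
  ...   | yes vr | no _   = v , id ∷ All.map (λ below uv → T-trans vr (below (T-trans uv vr))) min

  least-in : {P : V → Set} → (∀ v → Dec (P v)) → (∀ {u v} → P u → P v → T u v ⊎ T v u) →
    ∀ {m} → P m → ∀ vs → ∃[ r ] (P r × All (λ u → P u → T r u) vs)
  least-in P? total {m} pm [] = m , pm , []
  least-in P? total pm (v ∷ vs) with least-in P? total pm vs
  ... | r , pr , below with P? v
  ...   | no ¬pv = r , pr , (λ pv → contradiction pv ¬pv) ∷ below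
  ...   | yes pv with total pr pv
  ...     | inj₁ rv = r , pr , (λ _ → rv) ∷ below
  ...     | inj₂ vr = v , pv , (λ _ → T-refl) ∷ All.map (λ to pu → T-trans vr (to pu)) below

-- The new edge joins a vertex reached from everywhere to one reaching everything.
module _ {n : ℕ} (G : Graph n) {K : VSet} {O : Fin n → Fin n → Set}
  (O-adj : ∀ {u v} → O u v → Adj G u v × OutK K u × OutK K v)
  (O-asym : ∀ {u v} → O u v → ¬ O v u)
  (O-total : ∀ {u v} → OutK K u → OutK K v → Adj G u v → O u v ⊎ O v u)
  (semiconnected : ∀ {u v} → OutK K u → OutK K v → Star O u v ⊎ Star O v u) where

  semiconnected⇒almost : ∀ {m} → OutK K m → AlmostTwoEdgeConnected G K
  semiconnected⇒almost m∉
    with least-in {T = Star O} ε _◅◅_ (λ v → K v ≟ᵇ false) semiconnected m∉ (allFin n)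
       | least-in {T = λ u v → Star O v u} ε (λ p q → q ◅◅ p) (λ v → K v ≟ᵇ false)
           (λ u∉ v∉ → swap (semiconnected u∉ v∉)) m∉ (allFin n)
  ... | p , p∉ , from-p | q , q∉ , to-q = inj₂ (p , q , p∉ , q∉ ,
      connect inj₁ , connect id , λ a b a∉ b∉ ab → [ without , flipped ∘ without ] (O-total a∉ b∉ ab))
    where
    p⇝ : ∀ {u} → OutK K u → Star O p u
    p⇝ = All.lookup from-p (∈-allFin _)
    ⇝q : ∀ {u} → OutK K u → Star O u q
    ⇝q = All.lookup to-q (∈-allFin _)
    connect : ∀ {T : Fin n → Fin n → Set} → (∀ {u v} → Adj G u v → T u v) → ConnectedOn (OutK K) T
    connect {T} emb u v u∉ v∉ = star⇒joined u∉ (reverse back (p⇝ u∉) ◅◅ gmap id forth (p⇝ v∉))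
      where
      forth : ∀ {u v} → O u v → T u v × OutK K v
      forth uv = emb (proj₁ (O-adj uv)) , proj₂ (proj₂ (O-adj uv))
      back : ∀ {u v} → O u v → T v u × OutK K u
      back uv = emb (adj-sym G (proj₁ (O-adj uv))) , proj₁ (proj₂ (O-adj uv))
    Remaining : Fin n → Fin n → Fin n → Fin n → Set
    Remaining a b u v = (Adj G u v × ¬ SameEdge u v a b) ⊎ SameEdge u v p q
    flipped : ∀ {a b} → ConnectedOn (OutK K) (Remaining b a) → ConnectedOn (OutK K) (Remaining a b)
    flipped conn u v u∉ v∉ = star⇒joined u∉ (gmap id
      (λ { (inj₁ (uv , ≠) , _ , v∉) → inj₁ (uv , ≠ ∘ same-flipʳ) , v∉ ; (inj₂ new , _ , v∉) → inj₂ new , v∉ })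
      (joined⇒star (conn u v u∉ v∉)))
    without : ∀ {a b} → O a b → ConnectedOn (OutK K) (Remaining a b)
    without {a} {b} ab u v u∉ v∉ = star⇒joined u∉
      (gmap id (λ (r , _ , v∉) → r , v∉) (J-sym (J-from-p u∉) ◅◅ J-from-p v∉))
      where
      J : Fin n → Fin n → Set
      J = Star λ u v → Remaining a b u v × OutK K u × OutK K v
      J-sym : ∀ {u v} → J u v → J v u
      J-sym = reverse λ { (r , u∉ , v∉) →
        Sum.map (λ (uv , ≠) → adj-sym G uv , ≠ ∘ same-flipˡ) same-flipˡ r , v∉ , u∉ }
      -- Keeps the parts before the first and after the last passage through `ab`.
      detour : ∀ {u v} → Star O u v → J u v ⊎ (J u a × J b v)
      detour ε = inj₁ ε
      detour (_◅_ {u} {w} uw r) with sameEdge? u w a b | detour r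
      ... | yes (inj₁ (refl , refl)) | inj₁ j       = inj₂ (ε , j)
      ... | yes (inj₁ (refl , refl)) | inj₂ (_ , j) = inj₂ (ε , j)
      ... | yes (inj₂ (refl , refl)) | _ = contradiction uw (O-asym ab)
      ... | no ≠ | inj₁ j       = inj₁ ((inj₁ (proj₁ (O-adj uw) , ≠) , proj₂ (O-adj uw)) ◅ j)
      ... | no ≠ | inj₂ (i , j) = inj₂ ((inj₁ (proj₁ (O-adj uw) , ≠) , proj₂ (O-adj uw)) ◅ i , j)
      -- If both walks use `ab`, then `p` and `u` are each joined to `a`; if only the one from `p`
      -- does, the new edge to `q` replaces it.
      J-from-p : ∀ {u} → OutK K u → J p u
      J-from-p u∉ with detour (p⇝ u∉) | detour (⇝q u∉)
      ... | inj₁ j | _ = j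
      ... | _ | inj₁ j = (inj₂ (inj₁ (refl , refl)) , p∉ , q∉) ◅ J-sym j
      ... | inj₂ (i , _) | inj₂ (j , _) = i ◅◅ J-sym j

-- A source among the 𝒮-free components

module _ {n : ℕ} (G : Graph n) (connected : Connected G) (nonbipartite : ¬ Bipartite G) where

  no-stubborn? : Decidable (AdjNoStubborn G)
  no-stubborn? u v = adj? G u v ×-dec ¬? (stubborn? G connected u v)

  no-stubborn-sym : ∀ {u v} → AdjNoStubborn G u v → AdjNoStubborn G v u
  no-stubborn-sym (uv , ¬stub) = adj-sym G uv , ¬stub ∘ stubborn-sym G

  componentOf : Fin n → VSet
  componentOf r v = does (reachable? no-stubborn? r v)

  component⁺ : ∀ {r v} → Star (AdjNoStubborn G) r v → v ∈ₛ componentOf r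
  component⁺ {r} {v} = dec-true (reachable? no-stubborn? r v)

  component⁻ : ∀ {r v} → v ∈ₛ componentOf r → Star (AdjNoStubborn G) r v
  component⁻ {r} {v} v∈ with reachable? no-stubborn? r v
  ... | yes p = p
  component⁻ () | no _

  componentOf-isComponent : ∀ r → SFreeComponent G (componentOf r)
  componentOf-isComponent r = (r , component⁺ ε) ,
    (λ u v u∈ v∈ → star⇒joined u (gmap id (λ {_} {v} uv → uv , v)
      (reverse no-stubborn-sym (component⁻ u∈) ◅◅ component⁻ v∈))) ,
    λ { u v u∈ (_ , walk , _) → component⁺ (component⁻ u∈ ◅◅ walk⇒star walk) }

  module _ (k : Fin n → Fin n → Bool) (k-sym : ∀ u v → k u v ≡ k v u)
    (linked : ∀ u v → ∃[ a ] ∃[ b ] Star (Alternating G k) (u , a) (v , b)) where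

    -- Every stubborn edge at K is traversed from the copy {(v , f v)} of K
    -- outwards.
    Source : VSet → (Fin n → Bool) → Set
    Source K f = ∀ {a b} → Stubborn G a b → b ∈ₛ K → k a b ≡ f b

    module _ {x y : Fin n} (stubborn : Stubborn G x y) {f : Fin n → Bool}
      (f-proper : BipartiteWithout G x y f) (kxy : k x y ≡ f x) where

      -- The copy `(v , f v)` with stubborn edges directed by their colours and the others usable
      -- both ways, `xy` being left out. A minimal vertex of the resulting preorder will give the
      -- source.
      Inward : Fin n → Fin n → Set
      Inward u v = AdjNoStubborn G u v ⊎ (Stubborn G u v × ¬ SameEdge u v x y × k u v ≡ f u)

      inward? : Decidable Inward
      inward? u v = no-stubborn? u v ⊎-dec
        (stubborn? G connected u v ×-dec ¬? (sameEdge? u v x y) ×-dec (k u v ≟ᵇ f u))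

      -- `ab` is a bridge of G without `xy`. Once on the side of `b`, a walk could come back only
      -- along `ba`, which is directed the other way.
      no-return : ∀ {a b} → Stubborn G a b → ¬ SameEdge a b x y → k a b ≡ f a → ¬ Star Inward b a
      no-return {a} {b} stub ≠xy kab back = differs (sym (preserve (λ v → h b ≡ h v) closed back refl))
        where
        g : Fin n → Bool
        g = halves G connected a b
        g-proper : BipartiteWithout G a b g
        g-proper = stubborn⇒bipartite G connected stub
        h : Fin n → Bool
        h v = f v xor g v
        differs : h a ≢ h b
        differs = flip-one (f-proper (proj₁ stub) ≠xy) (bipartite-ends G nonbipartite {f = g} g-proper)
        closed : ∀ {u v} → Inward u v → h b ≡ h u → h b ≡ h v
        closed (inj₁ (uv , ¬stub)) eq = trans eq (flip-both
          (f-proper uv λ { (inj₁ (refl , refl)) → ¬stub stubborn ; (inj₂ (refl , refl)) → ¬stub (stubborn-sym G stubborn) })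
          (g-proper uv λ { (inj₁ (refl , refl)) → ¬stub stub ; (inj₂ (refl , refl)) → ¬stub (stubborn-sym G stub) }))
        closed {u} {v} (inj₂ ((uv , _) , ≠ , kuv)) eq with sameEdge? u v a b
        ... | yes (inj₁ (refl , refl)) = refl
        ... | yes (inj₂ (refl , refl)) = contradiction (trans (sym kuv) (trans (k-sym b a) kab))
          (λ same → not-¬ (sym same) (f-proper uv ≠))
        ... | no ≠ab = trans eq (flip-both (f-proper uv ≠) (g-proper uv ≠ab))

      -- A stubborn edge directed into the component of a minimal `r` starts at a vertex that
      -- reaches `r` and so is reached from it, against `no-return`. The colour of `xy` is right at
      -- either end because `f x` equals `f y`.
      source-component : f x ≡ f y → ∃[ r ] Source (componentOf r) f
      source-component f-ends with minimal-in ε _◅◅_ (reachable? inward?) x (allFin n)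
      ... | r , minimal = r , source
        where
        source : Source (componentOf r) f
        source {a} {b} stub b∈ with sameEdge? a b x y | k a b ≟ᵇ f a
        ... | yes (inj₁ (refl , refl)) | _ = trans kxy f-ends
        ... | yes (inj₂ (refl , refl)) | _ = trans (k-sym y x) kxy
        ... | no ≠ | no neq = trans (¬-not neq) (sym (f-proper (proj₁ stub) ≠))
        ... | no ≠ | yes kab = contradiction
          (b⇝r ◅◅ All.lookup minimal (∈-allFin a) (inj₂ (stub , ≠ , kab) ◅ b⇝r)) (no-return stub ≠ kab)
          where
          b⇝r : Star Inward b r
          b⇝r = gmap id inj₁ (reverse no-stubborn-sym (component⁻ b∈))

    -- The complement of a source component

    module _ {K : VSet} (component : SFreeComponent G K) {x y : Fin n} (x∈ : x ∈ₛ K)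
      {f : Fin n → Bool} (f-proper : BipartiteWithout G x y f) (y∉ : OutK K y) (source : Source K f) where

      Orientation : Fin n → Fin n → Set
      Orientation u v = (Adj G u v × OutK K u × OutK K v) × k u v ≡ f u

      off-xy : ∀ {u v} → OutK K u → OutK K v → Adj G u v → f v ≡ not (f u)
      off-xy u∉ v∉ uv = f-proper uv λ
        { (inj₁ (refl , _)) → contradiction (trans (sym x∈) u∉) λ ()
        ; (inj₂ (_ , refl)) → contradiction (trans (sym x∈) v∉) λ () }

      -- Walks entering K get stuck in the copy {(v , not (f v))} of K.
      Trapped : State n → Set
      Trapped (v , a) = v ∈ₛ K × a ≡ not (f v)

      trapped-closed : ∀ {s t} → Alternating G k s t → Trapped s → Trapped t
      trapped-closed {u , a} {v , _} ((uv , eq) , refl) (u∈ , refl) with K v ≟ᵇ true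
      ... | yes v∈ = v∈ , cong not (sym (f-proper uv λ
        { (inj₁ (_ , refl)) → contradiction (trans (sym v∈) y∉) λ ()
        ; (inj₂ (refl , _)) → contradiction (trans (sym u∈) y∉) λ () }))
      ... | no v∉ = contradiction
        (trans (k-sym u v) (source (stubborn-sym G (leaving⇒stubborn G connected component u∈ (¬-not v∉) uv)) u∈))
        (λ eq′ → not-¬ eq′ eq)

      -- A walk that enters `K` cannot come out again, so this one stays outside, where the cover
      -- splits into two oppositely oriented copies. The first state tells which copy is used.
      untangle : ∀ {u a v b} → Star (Alternating G k) (u , a) (v , b) → OutK K u → OutK K v →
        (a ≡ f u → Star Orientation u v) × (a ≡ not (f u) → Star Orientation v u)
      untangle ε _ _ = (λ _ → ε) , λ _ → ε
      untangle {u} {a} (_◅_ {_} {w , _} ((uw , eq) , refl) p) u∉ v∉ with K w ≟ᵇ true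
      ... | yes w∈ = contradiction
        (trans (sym (proj₁ (preserve Trapped trapped-closed p (w∈ , cong not
          (trans (sym eq) (source (stubborn-sym G (leaving⇒stubborn G connected component w∈ u∉ (adj-sym G uw))) w∈))))))
          v∉) λ ()
      ... | no w∉ with ¬-not w∉
      ...   | w∉ with untangle p w∉ v∉ | off-xy u∉ w∉ uw
      ...     | fwd , bwd | fw =
        (λ a≡ → ((uw , u∉ , w∉) , trans eq a≡) ◅ fwd (trans (cong not a≡) (sym fw))) ,
        (λ a≡ → bwd (cong not (trans a≡ (sym fw))) ◅◅
          return ((adj-sym G uw , w∉ , u∉) , trans (k-sym w u) (trans eq (trans a≡ (sym fw)))))

      source⇒almost : AlmostTwoEdgeConnected G K
      source⇒almost = semiconnected⇒almost G {O = Orientation} proj₁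
        (λ { ((uv , u∉ , v∉) , e) ((_ , _ , _) , e′) →
          not-¬ refl (trans (sym e) (trans (k-sym _ _) (trans e′ (off-xy u∉ v∉ uv)))) })
        total semiconnected y∉
        where
        total : ∀ {u v} → OutK K u → OutK K v → Adj G u v → Orientation u v ⊎ Orientation v u
        total {u} {v} u∉ v∉ uv with k u v ≟ᵇ f u
        ... | yes eq = inj₁ ((uv , u∉ , v∉) , eq)
        ... | no neq = inj₂ ((adj-sym G uv , v∉ , u∉) ,
          trans (k-sym v u) (trans (¬-not neq) (sym (off-xy u∉ v∉ uv))))
        semiconnected : ∀ {u v} → OutK K u → OutK K v → Star Orientation u v ⊎ Star Orientation v u
        semiconnected {u} {v} u∉ v∉ with linked u v
        ... | a , b , p with untangle p u∉ v∉ | a ≟ᵇ f u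
        ...   | fwd , _ | yes eq = inj₁ (fwd eq)
        ...   | _ , bwd | no neq = inj₂ (bwd (¬-not neq))

    Goal : Set
    Goal = ∃[ K ] (SFreeComponent G K × (EmptyOutside K ⊎ AlmostTwoEdgeConnected G K))

    -- `xy` need not touch the component, so it is replaced by a stubborn edge leaving it. Being a
    -- source depends only on the values of `f` on the component.
    source⇒goal : ∀ {x y r f} → Stubborn G x y → BipartiteWithout G x y f → Source (componentOf r) f → Goal
    source⇒goal {x} {y} {r} {f} stubborn f-proper source with any? (λ v → componentOf r v ≟ᵇ false)
    ... | no all∈ = componentOf r , componentOf-isComponent r , inj₁ λ v → ¬-not λ v∉ → all∈ (v , v∉)
    ... | yes (v , v∉) with crossing-arc (componentOf r) (star-adj G connected r v) (component⁺ ε) v∉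
    ...   | x′ , y′ , xy′ , x∈ , y∉ = componentOf r , component , inj₂
      (source⇒almost component x∈ {f = f′} f′-proper y∉ λ {a} {b} stub b∈ → trans (source stub b∈) (sym (agree b∈)))
      where
      component = componentOf-isComponent r
      stub′ : Stubborn G x′ y′
      stub′ = leaving⇒stubborn G connected component x∈ y∉ xy′
      g : Fin n → Bool
      g = halves G connected x′ y′
      g-proper : BipartiteWithout G x′ y′ g
      g-proper = stubborn⇒bipartite G connected stub′
      f′ : Fin n → Bool
      -- The constant makes `f′` agree with `f` at `x′`, hence on the component, along whose
      -- non-stubborn edges both colourings alternate.
      f′ v = g v xor (f x′ xor g x′)
      f′-proper : BipartiteWithout G x′ y′ f′
      f′-proper {u} uv ≠ = trans (cong (_xor (f x′ xor g x′)) (g-proper uv ≠)) (sym (not-distribˡ-xor (g u) _))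
      step-const : ∀ {u v} → AdjNoStubborn G u v × u ∈ₛ componentOf r × v ∈ₛ componentOf r → f u xor g u ≡ f v xor g v
      step-const ((uv , ¬stub) , _) = flip-both
        (f-proper uv λ { (inj₁ (refl , refl)) → ¬stub stubborn ; (inj₂ (refl , refl)) → ¬stub (stubborn-sym G stubborn) })
        (g-proper uv λ { (inj₁ (refl , refl)) → ¬stub stub′ ; (inj₂ (refl , refl)) → ¬stub (stubborn-sym G stub′) })
      xor-cancel : ∀ p q → q xor (p xor q) ≡ p
      xor-cancel true  true  = refl
      xor-cancel true  false = refl
      xor-cancel false true  = refl
      xor-cancel false false = refl
      agree : ∀ {v} → v ∈ₛ componentOf r → f′ v ≡ f v
      agree {v} v∈ = trans (cong (g v xor_) (constant (λ v → f v xor g v) step-const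
        (component-walk G component x∈ v∈))) (xor-cancel (f v) (g v))

    linked⇒goal : Goal
    linked⇒goal with any? (λ x → any? λ y → stubborn? G connected x y)
    ... | no none = (λ _ → true) , ((root G connected nonbipartite , refl) ,
        (λ u v _ _ → star⇒joined u (gmap id (λ {u} {v} uv → (uv , λ stub → none (u , v , stub)) , v)
          (star-adj G connected u v))) , λ _ _ _ _ → refl) , inj₁ λ _ → refl
    ... | yes (x , y , stub) = go (k x y ≟ᵇ f x)
      where
      f : Fin n → Bool
      f = halves G connected x y
      f-proper : BipartiteWithout G x y f
      f-proper = stubborn⇒bipartite G connected stub
      f-ends : f x ≡ f y
      f-ends = bipartite-ends G nonbipartite {f = f} f-proper
      go : Dec (k x y ≡ f x) → Goal
      go (yes eq) = source⇒goal stub f-proper (proj₂ (source-component stub f-proper eq f-ends))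
      -- For the complementary 2-colouring, `xy` again leads out of the copy `(v , f v)`.
      go (no neq) = source⇒goal stub f⁻-proper
        (proj₂ (source-component stub {f = not ∘ f} f⁻-proper (¬-not neq) (cong not f-ends)))
        where
        f⁻-proper : BipartiteWithout G x y (not ∘ f)
        f⁻-proper uv ≠ = cong not (f-proper uv ≠)

  necessary : ProperColouring G → ∃[ K ] (SFreeComponent G K × (EmptyOutside K ⊎ AlmostTwoEdgeConnected G K))
  necessary (c , c-sym , proper) = linked⇒goal k (λ u v → cong toBool (c-sym u v)) linked
    where
    toBool : Fin 2 → Bool
    toBool zero       = false
    toBool (suc zero) = true
    toBool-injective : ∀ {i j} → toBool i ≡ toBool j → i ≡ j
    toBool-injective {zero}     {zero}     _ = refl
    toBool-injective {suc zero} {suc zero} _ = refl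
    toBool-injective {zero}     {suc zero} ()
    toBool-injective {suc zero} {zero}     ()
    k : Fin n → Fin n → Bool
    k u v = toBool (c u v)
    alternate : ∀ {u w vs v} → WalkFrom (Adj G) u (w ∷ vs) v → ProperlyColoured c (u ∷ w ∷ vs) →
      ∃[ b ] Star (Alternating G k) (u , k u w) (v , b)
    alternate (step uw (stop _)) _ = _ , return ((uw , refl) , refl)
    alternate (step uw walk@(step _ _)) (pc3 neq pc) with alternate walk pc
    ... | b , p = b , ((uw , refl) , ¬-not (neq ∘ sym ∘ toBool-injective)) ◅ p
    linked : ∀ u v → ∃[ a ] ∃[ b ] Star (Alternating G k) (u , a) (v , b)
    linked u v with proper u v
    ... | []     , stop _ , _ = false , false , ε
    ... | w ∷ vs , walk , pc  = _ , alternate walk pc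

theorem6 : (n : ℕ) (G : Graph n) → Connected G → ¬ Bipartite G →
    ((Σ Colouring λ c → IsColouring c × ProperlyConnected G c) →
    ∃[ K ] (SFreeComponent G K × (EmptyOutside K ⊎ AlmostTwoEdgeConnected G K)))
    × (∃[ K ] (SFreeComponent G K × (EmptyOutside K ⊎ AlmostTwoEdgeConnected G K)) →
    Σ Colouring λ c → IsColouring c × ProperlyConnected G c)
theorem6 n G connected nonbipartite =
  necessary G connected nonbipartite , sufficient G connected nonbipartite
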